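{- Let $\varepsilon, c>0$ be constants. Assume the set intersection hypothesis (every data structure solving the set intersection problem on $N$ sets requires $\tilde\Omega(N^2)$ space). Then any $(2-\varepsilon,c)$-stretch approximate distance oracle for graphs with $n$ vertices and maximum degree $\tilde\Theta(1)$ must use $\tilde\Omega(n^2)$ space.
   Context: Graphs are undirected and unweighted; $d(u,v)$ is the length of a shortest path between $u$ and $v$ ($\infty$ if there is none). An approximate distance oracle (ADO) for a graph $G=(V,E)$ is a data structure (word-RAM model, space counted in words) that, given any $u,v\in V$, returns in constant time an estimate $\hat d(u,v)$. It has $(\alpha,\beta)$-stretch if for all $u,v\in V$: $d(u,v)\le\hat d(u,v)\le\max\{d(u,v),\ \alpha\, d(u,v)+\beta\}$. Set intersection problem: let $X=\log^{c_0} N$ for a large enough constant $c_0$. Construct a data structure that preprocesses sets $S_1,\dots,S_N\subseteq[X]=\{1,\dots,X\}$ and answers queries of the form "does $S_i$ intersect $S_j$?" in constant time. Set intersection hypothesis: a data structure that solves the set intersection problem requires $\tilde\Omega(N^2)$ space. $\tilde\Omega(\cdot)$ and $\tilde\Theta(\cdot)$ suppress poly-logarithmic factors (so maximum degree $\tilde\Theta(1)$ means poly-logarithmic in $n$). The lower bound is for the worst case over graphs in the stated family. -}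

module Defs where

open import Data.Bool using (Bool; true; false; if_then_else_; _∧_; _∨_; _xor_)
open import Data.Fin using (Fin; toℕ)
open import Data.Fin.Subset using (Subset; _∈_; _∉_; _∩_; Nonempty; ∣_∣)
open import Data.Integer using (+_)
open import Data.List using (List; []; _∷_; length)
open import Data.Maybe using (Maybe; just; nothing)
open import Data.Nat
  using (ℕ; zero; suc; _+_; _*_; _∸_; _^_; _≤_; _≡ᵇ_; _<ᵇ_)
open import Data.Nat.DivMod using (_/_; _%_; _mod_)
open import Data.Nat.Logarithm using (⌈log₂_⌉)
open import Data.Nat.Properties using (m^n≢0)
open import Data.Product using (Σ; ∃; ∃-syntax; _×_; _,_; swap)
open import Data.Rational using (ℚ; 0ℚ) renaming (_/_ to _÷_)
import Data.Rational as ℚ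
import Data.Rational.Properties as ℚ
open import Data.Rational.Solver using (module +-*-Solver)
open import Data.Sum using (_⊎_)
import Data.Sum as Sum
open import Function using (_∘_; _⇔_; mk⇔; Equivalence)
open import Relation.Binary.PropositionalEquality using (_≡_; _≢_; refl; sym; subst)
open import Relation.Nullary using (¬_)
open import Relation.Nullary.Construct.Add.Supremum using (_⁺; [_]; ⊤⁺)
import Relation.Binary.Construct.Add.Supremum.NonStrict as Sup

-- Two-sided Dedekind cuts: `lower q` is q < x and `upper q` is x < q.
record ℝ : Set₁ where
  field
    lower upper : ℚ → Set
    lower-inhabited : ∃ lower
    upper-inhabited : ∃ upper
    lower-rounded   : ∀ q → lower q ⇔ (∃[ r ] q ℚ.< r × lower r)
    upper-rounded   : ∀ q → upper q ⇔ (∃[ r ] r ℚ.< q × upper r)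
    disjoint        : ∀ q → ¬ (lower q × upper q)
    located         : ∀ q r → q ℚ.< r → lower q ⊎ upper r

open ℝ public

Positive : ℝ → Set
Positive x = lower x 0ℚ

private
  flip-< : ∀ a {q r} → q ℚ.< r → a ℚ.- r ℚ.< a ℚ.- q
  flip-< a q<r = ℚ.+-monoʳ-< a (ℚ.neg-antimono-< q<r)

  involutive : ∀ a q → a ℚ.- (a ℚ.- q) ≡ q
  involutive = solve 2 (λ a q → a :- (a :- q) := q) refl
    where open +-*-Solver

  flip-<ˡ : ∀ a {q r} → a ℚ.- q ℚ.< r → a ℚ.- r ℚ.< q
  flip-<ˡ a {q} {r} p = subst (a ℚ.- r ℚ.<_) (involutive a q) (flip-< a p)

  flip-<ʳ : ∀ a {q r} → r ℚ.< a ℚ.- q → q ℚ.< a ℚ.- r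
  flip-<ʳ a {q} {r} p = subst (ℚ._< a ℚ.- r) (involutive a q) (flip-< a p)

infixl 6 _⊖_

_⊖_ : ℚ → ℝ → ℝ
a ⊖ x = record
  { lower = λ q → upper x (a ℚ.- q)
  ; upper = λ q → lower x (a ℚ.- q)
  ; lower-inhabited = let q , p = upper-inhabited x in
      a ℚ.- q , subst (upper x) (sym (involutive a q)) p
  ; upper-inhabited = let q , p = lower-inhabited x in
      a ℚ.- q , subst (lower x) (sym (involutive a q)) p
  ; lower-rounded = λ q → mk⇔
      (λ p → let r , r< , u = Equivalence.to (upper-rounded x (a ℚ.- q)) p in
        a ℚ.- r , flip-<ʳ a r< , subst (upper x) (sym (involutive a r)) u)
      (λ (r , q<r , u) → Equivalence.from (upper-rounded x (a ℚ.- q))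
        (a ℚ.- r , flip-< a q<r , u))
  ; upper-rounded = λ q → mk⇔
      (λ p → let r , <r , l = Equivalence.to (lower-rounded x (a ℚ.- q)) p in
        a ℚ.- r , flip-<ˡ a <r , subst (lower x) (sym (involutive a r)) l)
      (λ (r , r<q , l) → Equivalence.from (lower-rounded x (a ℚ.- q))
        (a ℚ.- r , flip-< a r<q , l))
  ; disjoint = λ q → disjoint x (a ℚ.- q) ∘ swap
  ; located  = λ q r q<r →
      Sum.swap (located x (a ℚ.- r) (a ℚ.- q) (flip-< a q<r))
  }

-- g = Ω̃(f), with ⌈log₂ n⌉ for log n.
Ω̃ : (f g : ℕ → ℕ) → Set
Ω̃ f g = ∃[ C ] ∃[ k ] ∃[ n₀ ] ∀ n → n₀ ≤ n → f n ≤ C * ⌈log₂ n ⌉ ^ k * g n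

Word : ℕ → Set
Word w = Fin (2 ^ w)

word : ∀ w → ℕ → Word w
word w k = (k mod (2 ^ w)) {{m^n≢0 2 w}}

data Op : Set where
  add sub mul div mod and or xor shl shr eq lt : Op

bit : Bool → ℕ
bit b = if b then 1 else 0

-- Applies f to the w lowest binary digits.
bitwise : (Bool → Bool → Bool) → ℕ → ℕ → ℕ → ℕ
bitwise f zero    x y = 0
bitwise f (suc w) x y =
  bit (f (x % 2 ≡ᵇ 1) (y % 2 ≡ᵇ 1)) + 2 * bitwise f w (x / 2) (y / 2)

-- x div 0 = 0 and x mod 0 = x.
quot rem : ℕ → ℕ → ℕ
quot x zero    = 0
quot x (suc y) = x / suc y
rem x zero    = x
rem x (suc y) = x % suc y

-- The result is afterwards reduced modulo 2 ^ w, so adding 2 ^ w in `sub`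
-- makes it wrap around.
evalℕ : Op → ℕ → ℕ → ℕ → ℕ
evalℕ add w x y = x + y
evalℕ sub w x y = (2 ^ w + x) ∸ y
evalℕ mul w x y = x * y
evalℕ div w x y = quot x y
evalℕ mod w x y = rem x y
evalℕ and w x y = bitwise _∧_ w x y
evalℕ or  w x y = bitwise _∨_ w x y
evalℕ xor w x y = bitwise _xor_ w x y
evalℕ shl w x y = x * 2 ^ y
evalℕ shr w x y = quot x (2 ^ y)
evalℕ eq  w x y = bit (x ≡ᵇ y)
evalℕ lt  w x y = bit (x <ᵇ y)

eval : ∀ w → Op → Word w → Word w → Word w
eval w o x y = word w (evalℕ o w (toℕ x) (toℕ y))

Reg : Set
Reg = ℕ

-- Every instruction names its successor(s), as in a flowchart.  The address
-- used by `load` and `store` is the contents of the register `base` plus the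
-- literal offset; the sum is not reduced modulo 2 ^ w.
data Instr (Label : Set) : Set where
  const  : (dst : Reg) (literal : ℕ) → Label → Instr Label
  arith  : Op → (dst src₁ src₂ : Reg) → Label → Instr Label
  load   : (dst base : Reg) (offset : ℕ) → Label → Instr Label
  store  : (base : Reg) (offset : ℕ) (src : Reg) → Label → Instr Label
  ifzero : (src : Reg) (then else : Label) → Instr Label
  halt   : Instr Label

record Program : Set where
  field
    size  : ℕ
    entry : Fin size
    code  : Fin size → Instr (Fin size)

open Program public

Store : ℕ → Set
Store w = ℕ → Word w

infixl 9 _[_≔_]

_[_≔_] : {A : Set} → (ℕ → A) → ℕ → A → (ℕ → A)
(s [ i ≔ x ]) j = if i ≡ᵇ j then x else s j

-- The contents of the registers 0 and 1 when the program halts.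
Output : Set
Output = ℕ × ℕ

data State (w : ℕ) (Label : Set) : Set where
  running : Label → (regs mem : Store w) → State w Label
  halted  : Output → State w Label

step : ∀ w {Label} → Instr Label → (regs mem : Store w) → State w Label
step w (const d k l)     r m = running l (r [ d ≔ word w k ]) m
step w (arith o d x y l) r m = running l (r [ d ≔ eval w o (r x) (r y) ]) m
step w (load d b k l)    r m = running l (r [ d ≔ m (toℕ (r b) + k) ]) m
step w (store b k x l)   r m = running l r (m [ toℕ (r b) + k ≔ r x ])
step w (ifzero x l l′)   r m = running (if toℕ (r x) ≡ᵇ 0 then l else l′) r m
step w halt              r m = halted (toℕ (r 0) , toℕ (r 1))

-- `nothing` if the program has not halted after t steps.
run : ∀ w (p : Program) → ℕ → State w (Fin (size p)) → Maybe Output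
run w p t       (halted out)    = just out
run w p zero    (running _ _ _) = nothing
run w p (suc t) (running l r m) = run w p t (step w (code p l) r m)

contents : ∀ w → List (Word w) → Store w
contents w []       _       = word w 0
contents w (x ∷ xs) zero    = x
contents w (x ∷ xs) (suc a) = contents w xs a

-- The two query arguments are in the registers 0 and 1.
arguments : ∀ w → ℕ → ℕ → Store w
arguments w x y = contents w (word w x ∷ word w y ∷ [])

query : ∀ w → Program → (time : ℕ) → List (Word w) → ℕ → ℕ → Maybe Output
query w p time memory x y =
  run w p time (running (entry p) (arguments w x y) (contents w memory))

-- `Correct I i j out` says that `out` is an acceptable answer to the query
-- (i , j) on the instance I.
record Problem : Set₁ where
  field
    Instance : ℕ → Set
    Correct  : ∀ {n} → Instance n → Fin n → Fin n → Output → Set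

open Problem public

-- The words have Θ(log n) bits.  The query program and the bound `time` do not
-- depend on n, which is what makes the query time constant.  Every query starts
-- from the preprocessed memory; cells it writes to are scratch.
record DataStructure (P : Problem) : Set where
  field
    wordSize       : ℕ → ℕ
    wordSize-lower : ∀ n → n ≤ 2 ^ wordSize n
    wordSize-upper : ∃[ C ] ∀ n → wordSize n ≤ C * suc ⌈log₂ n ⌉

    space      : ℕ → ℕ
    preprocess : ∀ {n} → Instance P n → List (Word (wordSize n))
    preprocess-space : ∀ {n} (I : Instance P n) → length (preprocess I) ≤ space n

    program : Program
    time    : ℕ
    correct : ∀ {n} (I : Instance P n) (i j : Fin n) →
      ∃[ out ]
        query (wordSize n) program time (preprocess I) (toℕ i) (toℕ j) ≡ just out
        × Correct P I i j out

open DataStructure public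

RequiresSpace : Problem → (ℕ → ℕ) → Set
RequiresSpace P f = (D : DataStructure P) → Ω̃ f (space D)

SetIntersection : (c₀ : ℕ) → Problem
SetIntersection c₀ = record
  { Instance = λ N → Fin N → Subset (⌈log₂ N ⌉ ^ c₀)
  ; Correct  = λ S i j (answer , _) → answer ≢ 0 ⇔ Nonempty (S i ∩ S j)
  }

SetIntersectionHypothesis : Set
SetIntersectionHypothesis =
  ∃[ c₀ ] RequiresSpace (SetIntersection c₀) (λ N → N ^ 2)

record Graph (n : ℕ) : Set where
  field
    neighbours  : Fin n → Subset n
    symmetric   : ∀ {u v} → v ∈ neighbours u → u ∈ neighbours v
    irreflexive : ∀ {u} → u ∉ neighbours u

open Graph public

degree : ∀ {n} → Graph n → Fin n → ℕ
degree G v = ∣ neighbours G v ∣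

MaxDegree≤ : ∀ {n} → ℕ → Graph n → Set
MaxDegree≤ Δ G = ∀ v → degree G v ≤ Δ

data Walk {n} (G : Graph n) : ℕ → Fin n → Fin n → Set where
  nil  : ∀ {u} → Walk G 0 u u
  cons : ∀ {ℓ u v x} → v ∈ neighbours G u → Walk G ℓ v x → Walk G (suc ℓ) u x

-- `IsDistance G u v d` says that d(u , v) = d.  A shortest walk is a path.
IsDistance : ∀ {n} → Graph n → Fin n → Fin n → ℕ ⁺ → Set
IsDistance G u v [ d ] = Walk G d u v × (∀ ℓ → Walk G ℓ u v → d ≤ ℓ)
IsDistance G u v ⊤⁺    = ∀ ℓ → ¬ Walk G ℓ u v

open Sup ℚ._≤_ public using (_≤⁺_)

fromℕ⁺ : ℕ ⁺ → ℚ ⁺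
fromℕ⁺ [ d ] = [ + d ÷ 1 ]
fromℕ⁺ ⊤⁺    = ⊤⁺

stretched : ℚ → ℚ → ℚ ⁺ → ℚ ⁺
stretched a b [ d ] = [ d ℚ.⊔ (a ℚ.* d ℚ.+ b) ]
stretched a b ⊤⁺    = ⊤⁺

-- d ≤ e ≤ max {d , α d + β}.  As d ≥ 0, the real number max {d , α d + β} is the
-- infimum of max {d , a d + b} over all rational a > α and b > β.
WithinStretch : ℝ → ℝ → (d e : ℚ ⁺) → Set
WithinStretch α β d e =
  d ≤⁺ e × (∀ a b → upper α a → upper β b → e ≤⁺ stretched a b d)

-- An estimate is returned as a fraction of two words, with x / 0 meaning ∞.
estimate : Output → ℚ ⁺
estimate (x , zero)  = ⊤⁺
estimate (x , suc y) = [ + x ÷ suc y ]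

-- (α , β)-stretch oracles for graphs with n vertices and maximum degree at most
-- log^k n.
DistanceOracle : (α β : ℝ) (k : ℕ) → Problem
DistanceOracle α β k = record
  { Instance = λ n → Σ (Graph n) (MaxDegree≤ (⌈log₂ n ⌉ ^ k))
  ; Correct  = λ (G , _) u v out → ∀ d → IsDistance G u v d →
      WithinStretch α β (fromℕ⁺ d) (estimate out)
  }

{-# OPTIONS --safe #-}

-- Let L be a large multiple of log N.  Given N sets over a universe of
-- polylogarithmic size, take two vertices for every set and one binary heap of
-- depth O(log N) for every element, whose nodes are indexed by the set vertices;
-- a path of length L joins a set vertex to its own node in the heap of each of
-- its elements.  Degrees and the blow-up in the number of vertices are
-- polylogarithmic.  The two vertices of intersecting sets are at distance
-- 2 L + O(log N), those of disjoint sets at distance at least 4 L, and a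
-- (2 − ε , c)-stretch estimate tells these cases apart.
--
-- The space of the oracle need not be monotone in n.  To bound it at every n, the
-- instance with N sets is padded to the number of vertices, among those from
-- order N to order (N + 1), for which the oracle is smallest.

module Submission where

open import Defs
open import Data.Bool using (Bool; true; false; T)
import Data.Bool.Properties as Bool
import Data.Empty as Empty
open import Data.Fin using (Fin; zero; suc; toℕ; fromℕ; fromℕ<; punchIn; punchOut; splitAt; _↑ˡ_; _↑ʳ_)
open import Data.Fin.Patterns
import Data.Fin.Properties as Fin
open import Data.Fin.Subset using (Subset; _∈_; _∩_; Nonempty; ∣_∣; inside; outside; ⊤; ⊥)
open import Data.Fin.Subset.Properties using (_∈?_; nonempty?; x∈p∩q⁺; x∈p∩q⁻; ∈⊤; ∉⊥)
open import Data.Integer using (+_; +[1+_]; -[1+_])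
import Data.Integer as ℤ
import Data.Integer.Properties as ℤ
open import Data.List using (List; []; _∷_; length)
open import Data.Maybe using (just)
open import Data.Maybe.Properties using (just-injective)
open import Data.Nat hiding (_/_)
import Data.Nat as ℕ
open import Data.Nat.DivMod using (m<n⇒m%n≡m; m/n≤m; m%n<n; m<n*o⇒m/o<n; m*n/n≡m; /-monoˡ-≤)
open import Data.Nat.Induction using (<-rec)
open import Data.Nat.Logarithm using (⌈log₂_⌉; ⌈log₂⌉-mono-≤; ⌈log₂2^n⌉≡n; ⌈log₂⌈n/2⌉⌉≡⌈log₂n⌉∸1)
open import Data.Nat.Properties
open import Data.Nat.Solver using (module +-*-Solver)
open import Data.Product using (∃-syntax; _×_; _,_; proj₁; proj₂; swap)
open import Data.Product.Function.NonDependent.Propositional using (_×-↔_)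
open import Data.Rational using (ℚ; mkℚ; 0ℚ; _/_)
import Data.Rational as ℚ
import Data.Rational.Properties as ℚ
open import Data.Rational.Unnormalised using (mkℚᵘ; *≡*; *<*)
import Data.Rational.Unnormalised as ℚᵘ
import Data.Rational.Unnormalised.Properties as ℚᵘ
open import Data.Sum using (_⊎_; inj₁; inj₂)
import Data.Sum as Sum
open import Data.Sum.Function.Propositional using (_⊎-↔_)
open import Data.Vec using ([]; _∷_; tabulate; here; there)
open import Data.Vec.Properties using (lookup∘tabulate; []=⇒lookup; lookup⇒[]=)
open import Function using (_∘_; _⇔_; mk⇔; Equivalence; _↔_; Inverse; Injective)
import Function.Construct.Composition as Comp
import Function.Construct.Identity as Id
open import Relation.Binary using (Symmetric; Decidable)
open import Relation.Binary.PropositionalEquality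
import Relation.Binary.Construct.Add.Supremum.NonStrict as Sup
open import Relation.Nullary using (¬_; Dec; yes; no; does; contradiction; _×-dec_; _⊎-dec_)
open import Relation.Nullary.Construct.Add.Supremum using ([_]; ⊤⁺)
open import Relation.Nullary.Decidable using (dec-true; dec-false; decidable-stable; toWitness; isYes≗does)

-- Graphs

-- The labels colour the edges at a vertex, which bounds its degree.
∣p∣≤labels : ∀ {n Δ} (p : Subset n) (Label : Fin n → Fin Δ → Set) →
  (∀ {v} → v ∈ p → ∃[ k ] Label v k) →
  (∀ {v v′ k} → Label v k → Label v′ k → v ≡ v′) → ∣ p ∣ ≤ Δ
∣p∣≤labels [] Label label unique = z≤n
∣p∣≤labels (outside ∷ p) Label label unique =
  ∣p∣≤labels p (Label ∘ suc) (label ∘ there) (λ l l′ → Fin.suc-injective (unique l l′))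
∣p∣≤labels {Δ = zero} (inside ∷ p) Label label unique with label here
... | () , _
∣p∣≤labels {Δ = suc Δ} (inside ∷ p) Label label unique with label here
-- The label `k₀` of the first vertex is removed from the palette; by uniqueness no later vertex
-- carries it.
... | k₀ , l₀ = s≤s (∣p∣≤labels p (λ v k → Label (suc v) (punchIn k₀ k)) label′
                      (λ l l′ → Fin.suc-injective (unique l l′)))
  where
  label′ : ∀ {v} → v ∈ p → ∃[ k ] Label (suc v) (punchIn k₀ k)
  label′ {v} v∈p with label (there v∈p)
  ... | k , l with k₀ Fin.≟ k
  ...   | yes refl = contradiction (unique l l₀) λ ()
  ...   | no k₀≢k  = punchOut k₀≢k , subst (Label (suc v)) (sym (Fin.punchIn-punchOut k₀≢k)) l

module _ {n} {G : Graph n} where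

  infixr 5 _◅◅_

  _◅◅_ : ∀ {a b u v w} → Walk G a u v → Walk G b v w → Walk G (a + b) u w
  nil      ◅◅ q = q
  cons e p ◅◅ q = cons e (p ◅◅ q)

  reverse : ∀ {a u v} → Walk G a u v → Walk G a v u
  reverse nil = nil
  reverse {suc a} {u} {v} (cons e p) =
    subst (λ a → Walk G a v u) (+-comm a 1) (reverse p ◅◅ cons (symmetric G e) nil)

  -- Lower bounds on distances come from here: a potential that rises by at most one along every
  -- edge spares the analysis of individual walks.
  walk-lipschitz : (φ : Fin n → ℕ) → (∀ {u v} → v ∈ neighbours G u → φ v ≤ suc (φ u)) →
    ∀ {a u v} → Walk G a u v → φ v ≤ a + φ u
  walk-lipschitz φ lip nil = ≤-refl
  walk-lipschitz φ lip {suc a} {u} {v} (cons {v = x} e p) = begin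
    φ v             ≤⟨ walk-lipschitz φ lip p ⟩
    a + φ x         ≤⟨ +-monoʳ-≤ a (lip e) ⟩
    a + suc (φ u)   ≡⟨ +-suc a (φ u) ⟩
    suc a + φ u     ∎
    where open ≤-Reasoning

-- Lets a graph be given by a decidable relation on a structured type of vertices; `code` translates
-- to the numbers that `Graph` demands.
module RelationGraph {n} {V : Set} (code : Fin n ↔ V) {_~_ : V → V → Set}
  (_~?_ : Decidable _~_) (~-sym : Symmetric _~_) (~-irrefl : ∀ {v} → ¬ v ~ v) where

  open Inverse code using (to; from; strictlyInverseˡ; strictlyInverseʳ)

  to-injective : Injective _≡_ _≡_ to
  to-injective {u} {v} e = trans (sym (strictlyInverseʳ u)) (trans (cong from e) (strictlyInverseʳ v))

  adjacent : Fin n → Subset n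
  adjacent u = tabulate λ v → does (to u ~? to v)

  ∈-adjacent⁻ : ∀ {u v} → v ∈ adjacent u → to u ~ to v
  ∈-adjacent⁻ {u} {v} v∈ =
    toWitness {a? = to u ~? to v} (subst T (trans (sym e) (sym (isYes≗does (to u ~? to v)))) _)
    where
    e : does (to u ~? to v) ≡ true
    e = trans (sym (lookup∘tabulate _ v)) ([]=⇒lookup v∈)

  ∈-adjacent⁺ : ∀ {u v} → to u ~ to v → v ∈ adjacent u
  ∈-adjacent⁺ {u} {v} u~v =
    lookup⇒[]= v _ (trans (lookup∘tabulate _ v) (dec-true (to u ~? to v) u~v))

  graph : Graph n
  graph = record
    { neighbours  = adjacent
    ; symmetric   = ∈-adjacent⁺ ∘ ~-sym ∘ ∈-adjacent⁻
    ; irreflexive = ~-irrefl ∘ ∈-adjacent⁻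
    }

  Path : ℕ → V → V → Set
  Path a u v = Walk graph a (from u) (from v)

  edge : ∀ {u v} → u ~ v → Path 1 u v
  edge {u} {v} u~v =
    cons (∈-adjacent⁺ (subst₂ _~_ (sym (strictlyInverseˡ u)) (sym (strictlyInverseˡ v)) u~v)) nil

  path-lipschitz : (φ : V → ℕ) → (∀ {u v} → u ~ v → φ v ≤ suc (φ u)) →
    ∀ {a u v} → Path a u v → φ v ≤ a + φ u
  path-lipschitz φ lip {a} {u} {v} p =
    subst₂ (λ x y → φ x ≤ a + φ y) (strictlyInverseˡ v) (strictlyInverseˡ u)
      (walk-lipschitz (φ ∘ to) (lip ∘ ∈-adjacent⁻) p)

  degree≤labels : ∀ {Δ} u (Label : V → Fin Δ → Set) →
    (∀ {v} → to u ~ v → ∃[ k ] Label v k) →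
    (∀ {v v′ k} → Label v k → Label v′ k → v ≡ v′) → degree graph u ≤ Δ
  degree≤labels u Label label unique =
    ∣p∣≤labels (adjacent u) (Label ∘ to) (label ∘ ∈-adjacent⁻)
      (λ l l′ → to-injective (unique l l′))

-- The gadget graph

Vertex : (S X M r : ℕ) → Set
Vertex S X M r = Fin S ⊎ (Fin S × Fin X × Fin (suc M)) ⊎ Fin r

pattern set s      = inj₁ s
pattern node s x p = inj₂ (inj₁ (s , x , p))
pattern pad v      = inj₂ (inj₂ v)

abstract
  vertex : ∀ S X M r → Fin (S + (S * (X * suc M) + r)) ↔ Vertex S X M r
  vertex S X M r = Comp.inverse Fin.+↔⊎ (Id.↔-id _ ⊎-↔
    Comp.inverse Fin.+↔⊎ (Comp.inverse Fin.*↔× (Id.↔-id _ ×-↔ Fin.*↔×) ⊎-↔ Id.↔-id _))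

  -- The query program gets vertex numbers from set indices by at most one addition; hence the set
  -- vertices come first in the numbering.
  toℕ-vertex-set : ∀ S X M r s → toℕ (Inverse.from (vertex S X M r) (set s)) ≡ toℕ s
  toℕ-vertex-set S X M r s = Fin.toℕ-↑ˡ s _

-- Array numbering of a binary heap with root 0; `t` is the parent.
IsParent : ℕ → ℕ → Set
IsParent t s = s ≡ 1 + 2 * t ⊎ s ≡ 2 + 2 * t

parent< : ∀ {s t} → IsParent t s → t < s
parent< {t = t} (inj₁ refl) = s≤s (m≤m+n t _)
parent< {t = t} (inj₂ refl) = s≤s (≤-trans (m≤m+n t _) (n≤1+n _))

parent⇒half : ∀ {s t} → IsParent t s → ⌊ pred s /2⌋ ≡ t
parent⇒half {t = t} (inj₁ refl) rewrite +-identityʳ t = sym (n≡⌊n+n/2⌋ t)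
parent⇒half {t = t} (inj₂ refl) rewrite +-identityʳ t = sym (n≡⌈n+n/2⌉ t)

half-parent : ∀ s → IsParent ⌊ s /2⌋ (suc s)
half-parent zero = inj₁ refl
half-parent (suc zero) = inj₂ refl
half-parent (suc (suc s)) = Sum.map (lift {1}) (lift {2}) (half-parent s)
  where
  lift : ∀ {k} → suc s ≡ k + 2 * ⌊ s /2⌋ → 3 + s ≡ k + 2 * suc ⌊ s /2⌋
  lift {k} e = begin
    3 + s                        ≡⟨ cong (λ z → 2 + z) e ⟩
    2 + (k + 2 * ⌊ s /2⌋)        ≡⟨ +-comm 2 _ ⟩
    k + 2 * ⌊ s /2⌋ + 2          ≡⟨ +-assoc k _ 2 ⟩
    k + (2 * ⌊ s /2⌋ + 2)        ≡⟨ cong (λ z → k + z) (trans (+-comm _ 2) (sym (*-suc 2 ⌊ s /2⌋))) ⟩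
    k + 2 * suc ⌊ s /2⌋          ∎
    where open ≡-Reasoning

parent : ∀ {S} (s : Fin S) → toℕ s ≢ 0 → ∃[ t ] IsParent (toℕ {S} t) (toℕ s)
parent {suc S} zero s≢0 = contradiction refl s≢0
parent {suc S} (suc s) s≢0 = fromℕ< t<S ,
  subst (λ t → IsParent t (suc (toℕ s))) (sym (Fin.toℕ-fromℕ< t<S)) (half-parent (toℕ s))
  where
  t<S : ⌊ toℕ s /2⌋ < suc S
  t<S = ≤-trans (parent< (half-parent (toℕ s))) (<⇒≤ (Fin.toℕ<n (suc s)))

root : ∀ {S} → Fin S → ∃[ r ] toℕ {S} r ≡ 0
root {suc S} _ = zero , refl

-- The vertex node s x p is at height p above node s of the heap of element x: the
-- vertices with p = 0 form the heap, and set s is attached at p = M if x ∈ T s.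
module Gadget {S X} (M r : ℕ) (T : Fin S → Subset X) where

  V : Set
  V = Vertex S X M r

  infix 4 _⟶_ _⟶?_ _~_ _~?_

  -- Edges are oriented towards the root: from a set vertex to the tops of its columns, down a
  -- column, from a heap node to its parent. A column exists for every set and every element; only
  -- its attachment to the set vertex depends on `T`, so the number of vertices does not.
  _⟶_ : V → V → Set
  set s ⟶ node t x p = s ≡ t × x ∈ T t × toℕ p ≡ M
  node s x p ⟶ node t y q = x ≡ y ×
    (s ≡ t × toℕ p ≡ suc (toℕ q) ⊎ toℕ p ≡ 0 × toℕ q ≡ 0 × IsParent (toℕ t) (toℕ s))
  _ ⟶ _ = Empty.⊥

  _⟶?_ : Decidable _⟶_
  set s ⟶? set t = no λ ()
  set s ⟶? node t x p = (s Fin.≟ t) ×-dec (x ∈? T t) ×-dec (toℕ p ≟ M)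
  set s ⟶? pad t = no λ ()
  node s x p ⟶? set t = no λ ()
  node s x p ⟶? node t y q = (x Fin.≟ y) ×-dec
    (((s Fin.≟ t) ×-dec (toℕ p ≟ suc (toℕ q))) ⊎-dec
     ((toℕ p ≟ 0) ×-dec (toℕ q ≟ 0) ×-dec
      ((toℕ s ≟ 1 + 2 * toℕ t) ⊎-dec (toℕ s ≟ 2 + 2 * toℕ t))))
  node s x p ⟶? pad t = no λ ()
  pad s ⟶? v = no λ ()

  _~_ : V → V → Set
  u ~ v = u ⟶ v ⊎ v ⟶ u

  _~?_ : Decidable _~_
  u ~? v = (u ⟶? v) ⊎-dec (v ⟶? u)

  ⟶-irrefl : ∀ {v} → ¬ v ⟶ v
  ⟶-irrefl {node s x p} (_ , inj₁ (_ , p≡1+p)) = 1+n≢n (sym p≡1+p)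
  ⟶-irrefl {node s x p} (_ , inj₂ (_ , _ , par)) = <-irrefl refl (parent< par)

  open RelationGraph (vertex S X M r) _~?_ Sum.swap Sum.[ ⟶-irrefl , ⟶-irrefl ] public

  setCode : Fin S → Fin (S + (S * (X * suc M) + r))
  setCode s = Inverse.from (vertex S X M r) (set s)

  toℕ-setCode : ∀ s → toℕ (setCode s) ≡ toℕ s
  toℕ-setCode = toℕ-vertex-set S X M r

  pad-isolated : ∀ {v w} → ¬ pad v ~ w
  pad-isolated {w = set _} (inj₁ ())
  pad-isolated {w = set _} (inj₂ ())
  pad-isolated {w = node _ _ _} (inj₁ ())
  pad-isolated {w = node _ _ _} (inj₂ ())
  pad-isolated {w = pad _} (inj₁ ())
  pad-isolated {w = pad _} (inj₂ ())

  -- A set vertex has at most one neighbour per element, a node at most six neighbours, a padding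
  -- vertex none; the sum serves as a common bound.
  degree≤ : ∀ u → degree graph u ≤ 6 + X
  degree≤ u = bound _ refl
    where
    bound : ∀ w → Inverse.to (vertex S X M r) u ≡ w → degree graph u ≤ 6 + X
    bound (set s) e = ≤-trans (degree≤labels u
                    (λ v x → v ≡ node s x (fromℕ M))
                    (λ {v} u~v → label (subst (_~ v) e u~v))
                    (λ l l′ → trans l (sym l′))) (m≤n+m X 6)
      where
      label : ∀ {v} → set s ~ v → ∃[ x ] v ≡ node s x (fromℕ M)
      label {set _} (inj₁ ())
      label {set _} (inj₂ ())
      label {pad _} (inj₁ ())
      label {pad _} (inj₂ ())
      label {node t x p} (inj₁ (refl , _ , p≡M)) =
        x , cong (node s x) (Fin.toℕ-injective (trans p≡M (sym (Fin.toℕ-fromℕ M))))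
    bound (pad v) e = ≤-trans (degree≤labels {Δ = 0} u (λ _ _ → Empty.⊥)
                    (λ {w} u~v → Empty.⊥-elim (pad-isolated {v} {w} (subst (_~ w) e u~v))) λ ()) z≤n
    bound (node s x p) e = ≤-trans (degree≤labels {Δ = 6} u Label
                    (λ {v} u~v → label (subst (_~ v) e u~v)) unique) (m≤m+n 6 X)
      where
      -- In order: the set vertex, the nodes below and above in the column, the heap parent and the
      -- two heap children.
      Label : V → Fin 6 → Set
      Label (set t) 0F = t ≡ s
      Label (node t y q) 1F = y ≡ x × t ≡ s × toℕ p ≡ suc (toℕ q)
      Label (node t y q) 2F = y ≡ x × t ≡ s × toℕ q ≡ suc (toℕ p)
      Label (node t y q) 3F = y ≡ x × toℕ q ≡ 0 × IsParent (toℕ t) (toℕ s)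
      Label (node t y q) 4F = y ≡ x × toℕ q ≡ 0 × toℕ t ≡ 1 + 2 * toℕ s
      Label (node t y q) 5F = y ≡ x × toℕ q ≡ 0 × toℕ t ≡ 2 + 2 * toℕ s
      Label _ _ = Empty.⊥

      label : ∀ {v} → node s x p ~ v → ∃[ k ] Label v k
      label {pad _} (inj₁ ())
      label {pad _} (inj₂ ())
      label {set t} (inj₂ (t≡s , _)) = 0F , t≡s
      label {node t y q} (inj₁ (refl , inj₁ (refl , e))) = 1F , refl , refl , e
      label {node t y q} (inj₂ (refl , inj₁ (refl , e))) = 2F , refl , refl , e
      label {node t y q} (inj₁ (refl , inj₂ (_ , q≡0 , par))) = 3F , refl , q≡0 , par
      label {node t y q} (inj₂ (refl , inj₂ (q≡0 , _ , inj₁ e))) = 4F , refl , q≡0 , e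
      label {node t y q} (inj₂ (refl , inj₂ (q≡0 , _ , inj₂ e))) = 5F , refl , q≡0 , e

      parent-unique : ∀ {t t′ : Fin S} {s} → IsParent (toℕ t) s → IsParent (toℕ t′) s → t ≡ t′
      parent-unique par par′ = Fin.toℕ-injective (trans (sym (parent⇒half par)) (parent⇒half par′))

      node-≡ : ∀ {t t′ y y′} {q q′ : Fin (suc M)} → toℕ t ≡ toℕ t′ → y ≡ y′ → toℕ q ≡ toℕ q′ →
        _≡_ {A = V} (node t y q) (node t′ y′ q′)
      node-≡ t≡ refl q≡ with refl ← Fin.toℕ-injective t≡ | refl ← Fin.toℕ-injective q≡ = refl

      unique : ∀ {v v′ k} → Label v k → Label v′ k → v ≡ v′
      unique {set _} {set _} {0F} refl refl = refl
      unique {set _} {node _ _ _} {0F} _ ()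
      unique {set _} {pad _} {0F} _ ()
      unique {node _ _ _} {node _ _ _} {1F} (refl , refl , e) (refl , refl , e′) =
        node-≡ refl refl (suc-injective (trans (sym e) e′))
      unique {node _ _ _} {node _ _ _} {2F} (refl , refl , e) (refl , refl , e′) =
        node-≡ refl refl (trans e (sym e′))
      unique {node _ _ _} {node _ _ _} {3F} (refl , q≡0 , par) (refl , q′≡0 , par′) =
        node-≡ (cong toℕ (parent-unique par par′)) refl (trans q≡0 (sym q′≡0))
      unique {node _ _ _} {node _ _ _} {4F} (refl , q≡0 , e) (refl , q′≡0 , e′) =
        node-≡ (trans e (sym e′)) refl (trans q≡0 (sym q′≡0))
      unique {node _ _ _} {node _ _ _} {5F} (refl , q≡0 , e) (refl , q′≡0 , e′) =
        node-≡ (trans e (sym e′)) refl (trans q≡0 (sym q′≡0))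

  descend : ∀ p (p<L : p < suc M) {s x} → Path p (node s x (fromℕ< p<L)) (node s x zero)
  descend zero p<L = nil
  descend (suc p) p<L {s} {x} =
    edge {node s x (fromℕ< p<L)} {node s x (fromℕ< p<L′)}
      (inj₁ (refl , inj₁ (refl , trans (Fin.toℕ-fromℕ< p<L) (cong suc (sym (Fin.toℕ-fromℕ< p<L′))))))
    ◅◅ descend p p<L′
    where p<L′ = <-trans (n<1+n p) p<L

  -- Passing to the parent at least halves `suc s`, so the exponent `h` drops with every step; at
  -- exponent 0 only the root is left.
  climb : ∀ {root} → toℕ root ≡ 0 → ∀ h s → suc (toℕ s) ≤ 2 ^ h → ∀ x →
    ∃[ a ] a ≤ h × Path a (node s x zero) (node root x zero)
  climb {root} root≡0 h s s<2^h x with toℕ s ≟ 0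
  ... | yes s≡0 with refl ← Fin.toℕ-injective (trans s≡0 (sym root≡0)) = 0 , z≤n , nil
  climb {root} root≡0 zero s s<2^h x | no s≢0 = contradiction (n<1⇒n≡0 s<2^h) s≢0
  climb {root} root≡0 (suc h) s s<2^h x | no s≢0 with parent s s≢0
  ... | t , par with climb root≡0 h t (*-cancelˡ-≤ 2 (≤-trans (2t<s par) s<2^h)) x
    where
    2t<s : ∀ {t s} → IsParent t s → 2 * suc t ≤ suc s
    2t<s {t} (inj₁ refl) = ≤-reflexive (*-suc 2 t)
    2t<s {t} (inj₂ refl) = ≤-trans (≤-reflexive (*-suc 2 t)) (n≤1+n _)
  ...   | a , a≤h , p = suc a , s≤s a≤h ,
    edge {node s x zero} {node t x zero} (inj₁ (refl , inj₂ (refl , refl , par))) ◅◅ p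

  -- One edge to the top of the column, `M` edges down it and at most `h` edges up the heap.
  toRoot : ∀ {root} → toℕ root ≡ 0 → ∀ {h} → S ≤ 2 ^ h → ∀ {s x} → x ∈ T s →
    ∃[ a ] a ≤ suc M + h × Path a (set s) (node root x zero)
  toRoot root≡0 {h} S≤2^h {s} {x} x∈s with climb root≡0 h s (≤-trans (Fin.toℕ<n s) S≤2^h) x
  ... | a , a≤h , p = suc M + a , +-monoʳ-≤ (suc M) a≤h ,
    edge {set s} {node s x (fromℕ< ≤-refl)} (inj₁ (refl , x∈s , Fin.toℕ-fromℕ< ≤-refl))
    ◅◅ descend M ≤-refl ◅◅ p

  -- Both set vertices reach the root of the heap of a common element. The index `i` itself shows
  -- that node 0 exists.
  intersecting⇒close : ∀ {h} → S ≤ 2 ^ h → ∀ i j → Nonempty (T i ∩ T j) →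
    ∃[ a ] a ≤ 2 * (suc M + h) × Path a (set i) (set j)
  intersecting⇒close {h} S≤2^h i j (x , x∈∩)
    with x∈i , x∈j ← x∈p∩q⁻ (T i) (T j) x∈∩
    with a , a≤ , p ← toRoot {proj₁ (root i)} (proj₂ (root i)) S≤2^h x∈i
    with b , b≤ , q ← toRoot {proj₁ (root i)} (proj₂ (root i)) S≤2^h x∈j
    = a + b ,
      ≤-trans (+-mono-≤ a≤ b≤) (≤-reflexive (cong (λ z → suc M + h + z) (sym (+-identityʳ _)))) ,
      p ◅◅ reverse q

  module Potential {i j : Fin S} (i≢j : i ≢ j) (disjoint : ¬ Nonempty (T i ∩ T j)) where

    private
      L = suc M

      Near : ℕ → ℕ → Set
      Near a b = a ≤ suc b × b ≤ suc a

      near-refl : ∀ {a b} → a ≡ b → Near a b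
      near-refl refl = n≤1+n _ , n≤1+n _

      near-suc : ∀ {a b} → a ≡ suc b → Near a b
      near-suc refl = ≤-refl , ≤-trans (n≤1+n _) (n≤1+n _)

      near-∸ : ∀ a p → Near (a ∸ suc p) (a ∸ p)
      near-∸ zero p rewrite 0∸n≡0 p = near-refl refl
      near-∸ (suc a) zero = swap (near-suc refl)
      near-∸ (suc a) (suc p) = near-∸ a p

    -- A lower bound for the distance from set i: the heaps of elements of T i are
    -- contracted to a point at L, all others to a point at 3 L.
    setPotential : ∀ {s} → Dec (s ≡ i) → Dec (s ≡ j) → ℕ
    setPotential (yes _) _       = 0
    setPotential (no _)  (yes _) = 4 * L
    setPotential (no _)  (no _)  = 2 * L

    -- Along a column the potential changes by one per unit of height, from the value `L` or `3 * L`
    -- of the heap towards that of the set vertex if the column is attached to it.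
    nodePotential : ∀ {s x} → Dec (x ∈ T i) → Dec (s ≡ i) → Dec (s ≡ j) → ℕ → ℕ
    nodePotential (yes _) (yes _) _       p = L ∸ p
    nodePotential (yes _) (no _)  _       p = L + p
    nodePotential (no _)  _       (yes _) p = 3 * L + p
    nodePotential (no _)  _       (no _)  p = 3 * L ∸ p

    potential : V → ℕ
    potential (set s)      = setPotential (s Fin.≟ i) (s Fin.≟ j)
    potential (node s x p) = nodePotential (x ∈? T i) (s Fin.≟ i) (s Fin.≟ j) (toℕ p)
    potential (pad _)      = 0

    -- The potential would jump above the columns of `j` for elements of `T i` and above the columns
    -- of `i` for elements outside `T i`. The former are unattached because the two sets are
    -- disjoint, the latter by construction.
    near-top : ∀ {s x} → x ∈ T s → (d : Dec (x ∈ T i)) (e : Dec (s ≡ i)) (f : Dec (s ≡ j)) →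
      Near (setPotential e f) (nodePotential d e f M)
    near-top x∈s (yes _)   (yes _)    f          = swap (near-suc (m+n∸n≡m 1 M))
    near-top x∈s (yes x∈i) (no _)     (yes refl) = contradiction (_ , x∈p∩q⁺ (x∈i , x∈s)) disjoint
    near-top x∈s (yes _)   (no _)     (no _)     =
      near-suc (trans (cong (λ z → L + z) (+-identityʳ L)) (+-suc L M))
    near-top x∈s (no x∉i)  (yes refl) f          = contradiction x∈s x∉i
    near-top x∈s (no _)    (no _)     (yes _)    = near-suc (trans (+-comm L (3 * L)) (+-suc (3 * L) M))
    near-top x∈s (no _)    (no _)     (no _)     = swap (near-suc 3L∸M)
      where
      3L∸M : 3 * L ∸ M ≡ suc (2 * L)
      3L∸M = trans (+-∸-comm (2 * L) (n≤1+n M)) (cong (_+ 2 * L) (m+n∸n≡m 1 M))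

    near-step : ∀ {s x} (d : Dec (x ∈ T i)) (e : Dec (s ≡ i)) (f : Dec (s ≡ j)) p →
      Near (nodePotential d e f (suc p)) (nodePotential d e f p)
    near-step (yes _) (yes _) f       p = near-∸ L p
    near-step (yes _) (no _)  f       p = near-suc (+-suc L p)
    near-step (no _)  e       (yes _) p = near-suc (+-suc (3 * L) p)
    near-step (no _)  e       (no _)  p = near-∸ (3 * L) p

    -- A heap edge joins the feet of two columns of the same element, where the potential depends
    -- only on whether that element lies in `T i`.
    near-tree : ∀ {s t x} (d : Dec (x ∈ T i))
      (e : Dec (s ≡ i)) (f : Dec (s ≡ j)) (e′ : Dec (t ≡ i)) (f′ : Dec (t ≡ j)) →
      nodePotential d e f 0 ≡ nodePotential d e′ f′ 0
    near-tree d e f e′ f′ = trans (at-root d e f) (sym (at-root d e′ f′))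
      where
      base : ∀ {x} → Dec (x ∈ T i) → ℕ
      base (yes _) = L
      base (no _)  = 3 * L
      at-root : ∀ {s x} (d : Dec (x ∈ T i)) (e : Dec (s ≡ i)) (f : Dec (s ≡ j)) →
        nodePotential d e f 0 ≡ base d
      at-root (yes _) (yes _) f = refl
      at-root (yes _) (no _)  f = +-identityʳ _
      at-root (no _)  e (yes _) = +-identityʳ _
      at-root (no _)  e (no _)  = refl

    near : ∀ {u v} → u ⟶ v → Near (potential u) (potential v)
    near {set s} {node s x p} (refl , x∈s , p≡M) rewrite p≡M =
      near-top x∈s (x ∈? T i) (s Fin.≟ i) (s Fin.≟ j)
    near {node s x p} {node t x q} (refl , inj₁ (refl , p≡1+q)) rewrite p≡1+q =
      near-step (x ∈? T i) (s Fin.≟ i) (s Fin.≟ j) (toℕ q)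
    near {node s x p} {node t x q} (refl , inj₂ (p≡0 , q≡0 , _)) rewrite p≡0 | q≡0 =
      near-refl (near-tree (x ∈? T i) (s Fin.≟ i) (s Fin.≟ j) (t Fin.≟ i) (t Fin.≟ j))

    -- The potential is 0 at `set i` and `4 * L` at `set j`.
    disjoint⇒far : ∀ {a} → Path a (set i) (set j) → 4 * L ≤ a
    disjoint⇒far {a} p = subst₂ _≤_
      (φj (j Fin.≟ i) (j Fin.≟ j))
      (trans (cong (λ z → a + z) (φi (i Fin.≟ i))) (+-identityʳ a))
      (path-lipschitz potential (λ {u} {v} → lip {u} {v}) {u = set i} {v = set j} p)
      where
      lip : ∀ {u v} → u ~ v → potential v ≤ suc (potential u)
      lip {u} {v} (inj₁ e) = proj₂ (near {u} {v} e)
      lip {u} {v} (inj₂ e) = proj₁ (near {v} {u} e)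
      φj : (e : Dec (j ≡ i)) (f : Dec (j ≡ j)) → setPotential e f ≡ 4 * L
      φj (yes refl) _ = contradiction refl i≢j
      φj (no _) (yes _) = refl
      φj (no _) (no j≢j) = contradiction refl j≢j
      φi : (e : Dec (i ≡ i)) → setPotential e (i Fin.≟ j) ≡ 0
      φi (yes _) = refl
      φi (no i≢i) = contradiction refl i≢i

-- Word-RAM programs

toℕ-word : ∀ w {k} → k < 2 ^ w → toℕ (word w k) ≡ k
toℕ-word w {k} k<2^w =
  trans (Fin.toℕ-fromℕ< (m%n<n k (2 ^ w) {{m^n≢0 2 w}})) (m<n⇒m%n≡m {{m^n≢0 2 w}} k<2^w)

toℕ-word-0 : ∀ w → toℕ (word w 0) ≡ 0
toℕ-word-0 w = toℕ-word w (m^n>0 2 w)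

-- As in `estimate`, x / 0 is infinite.
below : ℕ → Output → Bool
below t (x , zero)  = false
below t (x , suc y) = x ℕ./ suc y <ᵇ t

module _ (p : Program) where

  private
    own : ℕ
    own = 9

    Label : Set
    Label = Fin (own + size p)

  -- The two cells in front are skipped through the literal offset, which costs no instruction and
  -- cannot wrap around. In place of halting, register 2, which `p` may have used, is cleared to
  -- serve as base address at label 3.
  relocate : Instr (Fin (size p)) → Instr Label
  relocate (const d k l)     = const d k (own ↑ʳ l)
  relocate (arith o d x y l) = arith o d x y (own ↑ʳ l)
  relocate (load d b k l)    = load d b (2 + k) (own ↑ʳ l)
  relocate (store b k x l)   = store b (2 + k) x (own ↑ʳ l)
  relocate (ifzero x l l′)   = ifzero x (own ↑ʳ l) (own ↑ʳ l′)
  relocate halt              = const 2 0 3F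

  -- Labels 0 to 2 add cell 1 to the second argument, relying on register 2 being 0 at the start,
  -- and clear register 2 before `p` begins. Labels 3 to 8 compare the output of `p` with cell 0;
  -- denominator 0 gives the answer 0.
  ownCode : Fin own → Instr Label
  ownCode 0F = load 2 2 1 1F
  ownCode 1F = arith add 1 1 2 2F
  ownCode 2F = const 2 0 (own ↑ʳ entry p)
  ownCode 3F = load 2 2 0 4F
  ownCode 4F = ifzero 1 8F 5F
  ownCode 5F = arith div 0 0 1 6F
  ownCode 6F = arith lt 0 0 2 7F
  ownCode 7F = halt
  ownCode 8F = const 0 0 7F

  -- Cells 0 and 1 hold t and a; the memory of p starts at cell 2.  On (x , y),
  -- runs p on (x , a + y) and tells whether its output is a fraction below t.
  decider : Program
  decider = record
    { size  = own + size p
    ; entry = 0F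
    ; code  = Sum.[ ownCode , relocate ∘ code p ] ∘ splitAt own
    }

  module Simulation (w : ℕ) (1<2^w : 1 < 2 ^ w) {t : ℕ} (t<2^w : t < 2 ^ w) where

    -- The invariant while `p` runs. Cell 0 keeps `t` because relocated stores only reach addresses
    -- from 2 on.
    record _≈_ (s s′ : Store w × Store w) : Set where
      constructor sim
      field
        regs≗ : ∀ i → proj₁ s′ i ≡ proj₁ s i
        mem≗  : ∀ a → proj₂ s′ (2 + a) ≡ proj₂ s a
        cell₀ : proj₂ s′ 0 ≡ word w t

    ≔-cong : {A : Set} {f g : ℕ → A} {x y : A} → (∀ i → f i ≡ g i) → x ≡ y →
      ∀ d i → (f [ d ≔ x ]) i ≡ (g [ d ≔ y ]) i
    ≔-cong f≗g x≡y d i with d ≡ᵇ i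
    ... | true  = x≡y
    ... | false = f≗g i

    finish : ∀ f r m r′ m′ → (r , m) ≈ (r′ , m′) →
      ∃[ z ] run w decider (6 + f) (running 3F (r′ [ 2 ≔ word w 0 ]) m′) ≡
        just (bit (below t (toℕ (r 0) , toℕ (r 1))) , z)
    finish f r m r′ m′ (sim r≗ m≗ c₀)
      rewrite sym (r≗ 0) | sym (r≗ 1) with toℕ (r′ 1) in e
    ... | zero  = _ , cong (λ x → just (x , toℕ (r′ 1))) (toℕ-word-0 w)
    ... | suc y = _ , cong (λ x → just (x , toℕ (r′ 1)))
        (trans (toℕ-bit (toℕ (word w (quot (toℕ (r′ 0)) (toℕ (r′ 1)))) <ᵇ toℕ (m′ (toℕ (word w 0) + 0))))
          (cong₂ (λ x y → bit (x <ᵇ y))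
            -- The quotient is at most the numerator, so reduction modulo `2 ^ w` leaves it
            -- unchanged.
            (trans (toℕ-word w (≤-<-trans (quot≤ _ (toℕ (r′ 1))) (Fin.toℕ<n (r′ 0)))) (cong (quot _) e))
            cell))
      where
      quot≤ : ∀ x y → quot x y ≤ x
      quot≤ x zero    = z≤n
      quot≤ x (suc y) = m/n≤m x (suc y)
      cell : toℕ (m′ (toℕ (word w 0) + 0)) ≡ t
      cell = trans (cong toℕ (trans (cong (λ a → m′ (a + 0)) (toℕ-word-0 w)) c₀)) (toℕ-word w t<2^w)
      toℕ-bit : ∀ b → toℕ (word w (bit b)) ≡ bit b
      toℕ-bit false = toℕ-word-0 w
      toℕ-bit true  = toℕ-word w 1<2^w

    address : ∀ {x y : Word w} k → x ≡ y → toℕ x + (2 + k) ≡ 2 + (toℕ y + k)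
    address {x} k refl = trans (+-suc (toℕ x) (suc k)) (cong suc (+-suc (toℕ x) k))

    -- Every instruction of `p` costs one instruction of the decider, so both clocks run in
    -- parallel; the six extra steps cover `finish`.
    simulate : ∀ f l r m r′ m′ → (r , m) ≈ (r′ , m′) → ∀ {out} →
      run w p f (running l r m) ≡ just out →
      ∃[ z ] run w decider (6 + f) (running (own ↑ʳ l) r′ m′) ≡ just (bit (below t out) , z)
    simulate (suc f) l r m r′ m′ s@(sim r≗ m≗ c₀) halts with code p l
    ... | const d k l₁ = simulate f l₁ _ _ _ _ (sim (≔-cong r≗ refl d) m≗ c₀) halts
    ... | arith o d x y l₁ =
      simulate f l₁ _ _ _ _ (sim (≔-cong r≗ (cong₂ (eval w o) (r≗ x) (r≗ y)) d) m≗ c₀) halts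
    ... | load d b k l₁ =
      simulate f l₁ _ _ _ _ (sim (≔-cong r≗ (trans (cong m′ (address k (r≗ b))) (m≗ _)) d) m≗ c₀) halts
    ... | store b k x l₁ rewrite address k (r≗ b) =
      simulate f l₁ _ _ _ _ (sim r≗ (≔-cong m≗ (r≗ x) (toℕ (r b) + k)) c₀) halts
    ... | ifzero x l₁ l₂ rewrite r≗ x with toℕ (r x) ≡ᵇ 0
    ...   | true  = simulate f l₁ _ _ _ _ s halts
    ...   | false = simulate f l₂ _ _ _ _ s halts
    simulate (suc f) l r m r′ m′ s refl | halt = finish f r m r′ m′ s

  decider-query : ∀ w → 1 < 2 ^ w → ∀ {t a} → t < 2 ^ w → a < 2 ^ w →
    ∀ f memory x y {out} → y < 2 ^ w → query w p f memory x (a + y) ≡ just out →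
    ∃[ z ] query w decider (9 + f) (word w t ∷ word w a ∷ memory) x y ≡ just (bit (below t out) , z)
  decider-query w 1<2^w {t} {a} t<2^w a<2^w f memory x y y<2^w halts =
    -- The first three of the `9 + f` steps are labels 0 to 2 and are carried out by computation.
    simulate f (entry p) (arguments w x (a + y)) (contents w memory) _ _
      (sim regs (λ _ → refl) refl) halts
    where
    open Simulation w 1<2^w t<2^w
    cells : Store w
    cells = contents w (word w t ∷ word w a ∷ memory)
    sum : eval w add (word w y) (cells (toℕ (word w 0) + 1)) ≡ word w (a + y)
    sum = cong (word w) (trans (cong₂ _+_ (toℕ-word w y<2^w)
      (trans (cong (λ b → toℕ (cells (b + 1))) (toℕ-word-0 w)) (toℕ-word w a<2^w))) (+-comm y a))
    regs : ∀ i → ((arguments w x y [ 2 ≔ cells (toℕ (word w 0) + 1) ])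
      [ 1 ≔ eval w add (word w y) (cells (toℕ (word w 0) + 1)) ] [ 2 ≔ word w 0 ]) i ≡ arguments w x (a + y) i
    regs 0 = refl
    regs 1 = sum
    regs 2 = refl
    regs (suc (suc (suc i))) = refl

-- Rational bounds on the stretch

-- The denominator is shifted by one.
frac : ℕ → ℕ → ℚ
frac x y = + x / suc y

frac-≃ : ∀ x y → ℚ.toℚᵘ (frac x y) ℚᵘ.≃ mkℚᵘ (+ x) y
frac-≃ x y = ℚ.toℚᵘ-fromℚᵘ (mkℚᵘ (+ x) y)

frac-≡ : ∀ x y z u → x * suc u ≡ z * suc y → frac x y ≡ frac z u
frac-≡ x y z u e = ℚ.fromℚᵘ-cong {mkℚᵘ (+ x) y} {mkℚᵘ (+ z) u} (*≡* (begin
  + x ℤ.* + suc u ≡⟨ ℤ.pos-* x (suc u) ⟨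
  + (x * suc u)   ≡⟨ cong +_ e ⟩
  + (z * suc y)   ≡⟨ ℤ.pos-* z (suc y) ⟩
  + z ℤ.* + suc y ∎))
  where open ≡-Reasoning

frac-< : ∀ x y z u → x * suc u < z * suc y → frac x y ℚ.< frac z u
frac-< x y z u p = ℚ.toℚᵘ-cancel-<
  (ℚᵘ.<-respˡ-≃ (ℚᵘ.≃-sym (frac-≃ x y)) (ℚᵘ.<-respʳ-≃ (ℚᵘ.≃-sym (frac-≃ z u))
    (*<* (subst₂ ℤ._<_ (ℤ.pos-* x (suc u)) (ℤ.pos-* z (suc y)) (ℤ.+<+ p)))))

frac-<⁻ : ∀ x y z u → frac x y ℚ.< frac z u → x * suc u < z * suc y
frac-<⁻ x y z u p
  with *<* q ← ℚᵘ.<-respˡ-≃ (frac-≃ x y) (ℚᵘ.<-respʳ-≃ (frac-≃ z u) (ℚ.toℚᵘ-mono-< p))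
  = ℤ.drop‿+<+ (subst₂ ℤ._<_ (sym (ℤ.pos-* x (suc u))) (sym (ℤ.pos-* z (suc y))) q)

frac-≤⁻ : ∀ x y z u → frac x y ℚ.≤ frac z u → x * suc u ≤ z * suc y
frac-≤⁻ x y z u p = ≮⇒≥ λ q → ℚ.<-irrefl refl (ℚ.<-≤-trans (frac-< z u x y q) p)

frac-* : ∀ x y z u → frac x y ℚ.* frac z u ≡ frac (x * z) (u + y * suc u)
frac-* x y z u = ℚ.toℚᵘ-injective (begin
  ℚ.toℚᵘ (frac x y ℚ.* frac z u)             ≈⟨ ℚ.toℚᵘ-homo-* (frac x y) (frac z u) ⟩
  ℚ.toℚᵘ (frac x y) ℚᵘ.* ℚ.toℚᵘ (frac z u)   ≈⟨ ℚᵘ.*-cong (frac-≃ x y) (frac-≃ z u) ⟩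
  mkℚᵘ (+ x ℤ.* + z) (u + y * suc u)         ≡⟨ cong (λ n → mkℚᵘ n (u + y * suc u)) (ℤ.pos-* x z) ⟨
  mkℚᵘ (+ (x * z)) (u + y * suc u)           ≈⟨ frac-≃ (x * z) _ ⟨
  ℚ.toℚᵘ (frac (x * z) (u + y * suc u))      ∎)
  where open ℚᵘ.≃-Reasoning

frac-+ : ∀ x y z u → frac x y ℚ.+ frac z u ≡ frac (x * suc u + z * suc y) (u + y * suc u)
frac-+ x y z u = ℚ.toℚᵘ-injective (begin
  ℚ.toℚᵘ (frac x y ℚ.+ frac z u)             ≈⟨ ℚ.toℚᵘ-homo-+ (frac x y) (frac z u) ⟩
  ℚ.toℚᵘ (frac x y) ℚᵘ.+ ℚ.toℚᵘ (frac z u)   ≈⟨ ℚᵘ.+-cong (frac-≃ x y) (frac-≃ z u) ⟩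
  mkℚᵘ (+ x ℤ.* + suc u ℤ.+ + z ℤ.* + suc y) (u + y * suc u)
    ≡⟨ cong (λ n → mkℚᵘ n (u + y * suc u)) (cong₂ ℤ._+_ (ℤ.pos-* x (suc u)) (ℤ.pos-* z (suc y))) ⟨
  mkℚᵘ (+ (x * suc u + z * suc y)) (u + y * suc u) ≈⟨ frac-≃ _ _ ⟨
  ℚ.toℚᵘ (frac (x * suc u + z * suc y) (u + y * suc u)) ∎)
  where open ℚᵘ.≃-Reasoning

lower-closed : ∀ x {q r} → q ℚ.< r → lower x r → lower x q
lower-closed x q<r l = Equivalence.from (lower-rounded x _) (_ , q<r , l)

upper-closed : ∀ x {q r} → q ℚ.< r → upper x q → upper x r
upper-closed x q<r u = Equivalence.from (upper-rounded x _) (_ , q<r , u)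

-- A positive fraction with denominator `d + 1` is at least `1 / (d + 1)`, hence above
-- `1 / (d + 2)`.
archimedean : ∀ q → 0ℚ ℚ.< q → ∃[ m ] frac 1 m ℚ.< q
archimedean q 0<q with ℚ.positive 0<q
archimedean q@(mkℚ +[1+ p ] d c) 0<q | _ = suc d ,
  subst (frac 1 (suc d) ℚ.<_) (ℚ.fromℚᵘ-toℚᵘ q) (frac-< 1 (suc d) (suc p) d
    (≤-trans (≤-reflexive (cong suc (*-identityˡ (suc d)))) (m≤m+n (suc (suc d)) _)))

-- A rational upper bound with numerator `n` is less than `∣ n ∣ + 1`.
upper-ℕ : ∀ x → ∃[ b ] upper x (frac (suc b) 0)
upper-ℕ x with upper-inhabited x
... | q@(mkℚ n d c) , u = ℤ.∣ n ∣ , upper-closed x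
  (subst (ℚ._< frac (suc ℤ.∣ n ∣) 0) (ℚ.fromℚᵘ-toℚᵘ q) (bound n d)) u
  where
  bound : ∀ n d → n / suc d ℚ.< frac (suc ℤ.∣ n ∣) 0
  bound (+ n) d = frac-< n d (suc n) 0 (≤-trans (s≤s (≤-reflexive (*-identityʳ n))) (m≤m*n (suc n) (suc d)))
  bound -[1+ n ] d = ℚ.toℚᵘ-cancel-< (ℚᵘ.<-respˡ-≃ (ℚᵘ.≃-sym (ℚ.toℚᵘ-fromℚᵘ (mkℚᵘ -[1+ n ] d)))
    (ℚᵘ.<-respʳ-≃ (ℚᵘ.≃-sym (frac-≃ (suc (suc n)) 0)) (*<* ℤ.-<+)))

-- The slope (1 + 2 m) / (m + 1) is 2 − 1 / (m + 1).
upper-slope : ∀ ε m → lower ε (frac 1 m) → upper ((+ 2 / 1) ⊖ ε) (frac (1 + 2 * m) m)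
upper-slope ε m = subst (lower ε) (begin
  frac 1 m                                              ≡⟨ ℚ.+-identityʳ _ ⟨
  frac 1 m ℚ.+ 0ℚ                                       ≡⟨ cong (frac 1 m ℚ.+_) (ℚ.+-inverseʳ a) ⟨
  frac 1 m ℚ.+ (a ℚ.- a)                                ≡⟨ ℚ.+-assoc (frac 1 m) a (ℚ.- a) ⟨
  frac 1 m ℚ.+ a ℚ.- a                                  ≡⟨ cong (ℚ._- a) 1/m+a≡2 ⟩
  (+ 2 / 1) ℚ.- a                                       ∎)
  where
  open ≡-Reasoning
  a = frac (1 + 2 * m) m
  sum≡2 : ∀ m → (1 * suc m + (1 + 2 * m) * suc m) * 1 ≡ 2 * (suc m * suc m)
  sum≡2 = solve 1 (λ m → (con 1 :* (con 1 :+ m) :+ (con 1 :+ con 2 :* m) :* (con 1 :+ m)) :* con 1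
                      := con 2 :* ((con 1 :+ m) :* (con 1 :+ m))) refl
    where open +-*-Solver
  1/m+a≡2 : frac 1 m ℚ.+ a ≡ frac 2 0
  1/m+a≡2 = trans (frac-+ 1 m (1 + 2 * m) m)
    (frac-≡ (1 * suc m + (1 + 2 * m) * suc m) (m + m * suc m) 2 0 (sum≡2 m))

slope-frac : ∀ m b d →
  frac (1 + 2 * m) m ℚ.* frac d 0 ℚ.+ frac b 0 ≡ frac ((1 + 2 * m) * d + b * suc m) m
slope-frac m b d = begin
  frac (1 + 2 * m) m ℚ.* frac d 0 ℚ.+ frac b 0
    ≡⟨ cong (ℚ._+ frac b 0) (frac-* (1 + 2 * m) m d 0) ⟩
  frac ((1 + 2 * m) * d) (m * 1) ℚ.+ frac b 0
    ≡⟨ cong (λ y → frac ((1 + 2 * m) * d) y ℚ.+ frac b 0) (*-identityʳ m) ⟩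
  frac ((1 + 2 * m) * d) m ℚ.+ frac b 0
    ≡⟨ frac-+ ((1 + 2 * m) * d) m b 0 ⟩
  frac ((1 + 2 * m) * d * 1 + b * suc m) (m * 1)
    ≡⟨ cong₂ (λ x y → frac (x + b * suc m) y) (*-identityʳ ((1 + 2 * m) * d)) (*-identityʳ m) ⟩
  frac ((1 + 2 * m) * d + b * suc m) m ∎
  where open ≡-Reasoning

⊔-lub-< : ∀ {p q r} → p ℚ.< r → q ℚ.< r → p ℚ.⊔ q ℚ.< r
⊔-lub-< {p} {q} {r} p<r q<r with ℚ.⊔-sel p q
... | inj₁ e = subst (ℚ._< r) (sym e) p<r
... | inj₂ e = subst (ℚ._< r) (sym e) q<r

-- As the threshold is a natural number, comparing it with the floor of a fraction amounts to
-- comparing it with the fraction itself.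
below-false : ∀ {t} d out → t ≤ d → fromℕ⁺ [ d ] ≤⁺ estimate out → below t out ≡ false
below-false d (x , zero) t≤d d≤est = refl
below-false {t} d (x , suc y) t≤d Sup.[ d≤est ] = ≥⇒<ᵇ-false (begin
  t                    ≤⟨ t≤d ⟩
  d                    ≡⟨ m*n/n≡m d (suc y) ⟨
  d * suc y ℕ./ suc y  ≤⟨ /-monoˡ-≤ (suc y) (frac-≤⁻ d 0 x y d≤est) ⟩
  x * 1 ℕ./ suc y      ≡⟨ cong (λ z → z ℕ./ suc y) (*-identityʳ x) ⟩
  x ℕ./ suc y          ∎)
  where
  open ≤-Reasoning
  ≥⇒<ᵇ-false : ∀ {m n} → n ≤ m → (m <ᵇ n) ≡ false
  ≥⇒<ᵇ-false {m} {n} n≤m = dec-false (m <? n) (≤⇒≯ n≤m)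

below-true : ∀ {t q} out → q ℚ.< frac t 0 → estimate out ≤⁺ [ q ] → below t out ≡ true
below-true (x , zero) q<t ()
below-true {t} (x , suc y) q<t Sup.[ est≤q ] = dec-true (x ℕ./ suc y <? t)
  (m<n*o⇒m/o<n (subst (_< t * suc y) (*-identityʳ x) (frac-<⁻ x y t 0 (ℚ.≤-<-trans est≤q q<t))))

-- The column length for which the gap between 2 (L + h) and 4 L exceeds the
-- stretch (2 − 1/(m + 1) , b).
columnLength : (m b h : ℕ) → ℕ
columnLength m b h = suc (suc m * (2 * h + b))

-- The factor `suc m` clears denominators. Adding `2 * (L + h)` on both sides, which avoids a
-- subtraction, completes the slope `1 + 2 * m` to `2 * suc m`; what remains,
-- `suc m * (4 * h + b) < 2 * (L + h)`, holds by the choice of `L`.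
gap : ∀ m b h {d} → d ≤ 2 * (columnLength m b h + h) →
  (1 + 2 * m) * d + b * suc m < 4 * columnLength m b h * suc m
gap m b h {d} d≤ = +-cancelʳ-< (2 * (L + h)) _ _ (begin-strict
  (1 + 2 * m) * d + b * suc m + 2 * (L + h)
    ≤⟨ +-monoˡ-≤ (2 * (L + h)) (+-monoˡ-≤ (b * suc m) (*-monoʳ-≤ (1 + 2 * m) d≤)) ⟩
  (1 + 2 * m) * (2 * (L + h)) + b * suc m + 2 * (L + h)
    ≡⟨ expand m b h L ⟩
  4 * L * suc m + suc m * (4 * h + b)
    <⟨ +-monoʳ-< (4 * L * suc m) (≤-trans (m≤m+n _ _) (≤-reflexive (slack m b h))) ⟩
  4 * L * suc m + 2 * (L + h) ∎)
  where
  open ≤-Reasoning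
  open +-*-Solver
  L = columnLength m b h
  expand : ∀ m b h L → (1 + 2 * m) * (2 * (L + h)) + b * suc m + 2 * (L + h) ≡
    4 * L * suc m + suc m * (4 * h + b)
  expand = solve 4 (λ m b h L →
    (con 1 :+ con 2 :* m) :* (con 2 :* (L :+ h)) :+ b :* (con 1 :+ m) :+ con 2 :* (L :+ h)
    := con 4 :* L :* (con 1 :+ m) :+ (con 1 :+ m) :* (con 4 :* h :+ b)) refl
  slack : ∀ m b h → suc (suc m * (4 * h + b)) + (1 + suc m * b + 2 * h) ≡ 2 * (suc (suc m * (2 * h + b)) + h)
  slack = solve 3 (λ m b h →
    con 1 :+ (con 1 :+ m) :* (con 4 :* h :+ b) :+ (con 1 :+ (con 1 :+ m) :* b :+ con 2 :* h)
    := con 2 :* (con 1 :+ (con 1 :+ m) :* (con 2 :* h :+ b) :+ h)) refl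

-- The stretch bound is a maximum: this handles its first argument `d`, and `gap` the second.
2[L+h]<4L : ∀ m b h → 2 * (columnLength m b h + h) < 4 * columnLength m b h
2[L+h]<4L m b h = ≤-trans (m≤m+n _ (1 + 2 * (m * (2 * h + b)) + (2 * h + 2 * b))) (≤-reflexive (slack m b h))
  where
  open +-*-Solver
  slack : ∀ m b h → suc (2 * (suc (suc m * (2 * h + b)) + h)) + (1 + 2 * (m * (2 * h + b)) + (2 * h + 2 * b))
    ≡ 4 * suc (suc m * (2 * h + b))
  slack = solve 3 (λ m b h → con 1 :+ con 2 :* (con 1 :+ (con 1 :+ m) :* (con 2 :* h :+ b) :+ h)
      :+ (con 1 :+ con 2 :* (m :* (con 2 :* h :+ b)) :+ (con 2 :* h :+ con 2 :* b))
    := con 4 :* (con 1 :+ (con 1 :+ m) :* (con 2 :* h :+ b))) refl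

module Stretch (ε c : ℝ) (m b : ℕ) (1/m<ε : lower ε (frac 1 m)) (c<b : upper c (frac b 0)) where

  close : ∀ h {d out} → d ≤ 2 * (columnLength m b h + h) →
    WithinStretch ((+ 2 / 1) ⊖ ε) c (fromℕ⁺ [ d ]) (estimate out) →
    below (4 * columnLength m b h) out ≡ true
  close h {d} {out} d≤ (_ , within) =
    below-true out bound (within (frac (1 + 2 * m) m) (frac b 0) (upper-slope ε m 1/m<ε) c<b)
    where
    t = 4 * columnLength m b h
    bound : frac d 0 ℚ.⊔ (frac (1 + 2 * m) m ℚ.* frac d 0 ℚ.+ frac b 0) ℚ.< frac t 0
    bound = ⊔-lub-< (frac-< d 0 t 0 (*-monoˡ-< 1 (≤-<-trans d≤ (2[L+h]<4L m b h))))
      (subst (ℚ._< frac t 0) (sym (slope-frac m b d))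
        (frac-< ((1 + 2 * m) * d + b * suc m) m t 0
          (≤-<-trans (≤-reflexive (*-identityʳ _)) (gap m b h d≤))))

-- Distances and sizes

-- If no length is the distance, strong induction excludes walks of every length, and then the
-- distance is infinite. The double negation is harmless: the goals are equations between booleans,
-- which are stable.
¬¬-distance : ∀ {n} (G : Graph n) u v → ¬ ¬ (∃[ d ] IsDistance G u v d)
¬¬-distance G u v none = none (⊤⁺ , <-rec (λ ℓ → ¬ Walk G ℓ u v) λ ℓ shorter walk →
  none ([ ℓ ] , walk , λ ℓ′ walk′ → ≮⇒≥ λ ℓ′<ℓ → shorter ℓ′<ℓ walk′))

module Threshold (ε c : ℝ) (m b : ℕ) (1/m<ε : lower ε (frac 1 m)) (c<b : upper c (frac b 0))
  {n} {G : Graph n} {u v out}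
  (within : ∀ d → IsDistance G u v d → WithinStretch ((+ 2 / 1) ⊖ ε) c (fromℕ⁺ d) (estimate out)) where

  open Stretch ε c m b 1/m<ε c<b

  walk⇒below : ∀ h {a} → a ≤ 2 * (columnLength m b h + h) → Walk G a u v →
    below (4 * columnLength m b h) out ≡ true
  walk⇒below h {a} a≤ walk = decidable-stable (_ Bool.≟ true) λ ≢true →
    ¬¬-distance G u v λ
      { ([ d ] , is-d) → ≢true (close h (≤-trans (proj₂ is-d a walk) a≤) (within [ d ] is-d))
      ; (⊤⁺ , no-walk) → no-walk a walk
      }

  no-walk⇒¬below : ∀ {t} → (∀ {a} → Walk G a u v → t ≤ a) → below t out ≡ false
  no-walk⇒¬below {t} far = decidable-stable (_ Bool.≟ false) λ ≢false →
    ¬¬-distance G u v λ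
      { ([ d ] , is-d) → ≢false (below-false d out (far (proj₁ is-d)) (proj₁ (within [ d ] is-d)))
      ; (⊤⁺ , is-d) → ≢false (infinite out (proj₁ (within ⊤⁺ is-d)))
      }
    where
    -- An infinite distance forces denominator 0, for which `below` is false.
    infinite : ∀ out → ⊤⁺ ≤⁺ estimate out → below t out ≡ false
    infinite (x , zero)  _ = refl
    infinite (x , suc y) ()

-- Logarithms and searches in the natural numbers

n≤2^⌈log₂n⌉ : ∀ n → n ≤ 2 ^ ⌈log₂ n ⌉
n≤2^⌈log₂n⌉ = <-rec (λ n → n ≤ 2 ^ ⌈log₂ n ⌉) bound
  where
  open ≤-Reasoning
  bound : ∀ n → (∀ {k} → k < n → k ≤ 2 ^ ⌈log₂ k ⌉) → n ≤ 2 ^ ⌈log₂ n ⌉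
  bound zero rec = z≤n
  bound (suc zero) rec = s≤s z≤n
  bound n@(suc (suc n₀)) rec = begin
    n                                  ≡⟨ ⌊n/2⌋+⌈n/2⌉≡n n ⟨
    ⌊ n /2⌋ + ⌈ n /2⌉                  ≤⟨ +-monoˡ-≤ ⌈ n /2⌉ (⌊n/2⌋≤⌈n/2⌉ n) ⟩
    ⌈ n /2⌉ + ⌈ n /2⌉                  ≡⟨ cong (λ k → ⌈ n /2⌉ + k) (+-identityʳ ⌈ n /2⌉) ⟨
    2 * ⌈ n /2⌉                        ≤⟨ *-monoʳ-≤ 2 (rec (⌈n/2⌉<n n₀)) ⟩
    2 * 2 ^ ⌈log₂ ⌈ n /2⌉ ⌉            ≡⟨ cong (λ k → 2 * 2 ^ k) (⌈log₂⌈n/2⌉⌉≡⌈log₂n⌉∸1 n) ⟩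
    2 ^ ⌈log₂ n ⌉                      ∎

⌈log₂⌉≤ : ∀ {n k} → n ≤ 2 ^ k → ⌈log₂ n ⌉ ≤ k
⌈log₂⌉≤ {n} {k} n≤ = subst (⌈log₂ n ⌉ ≤_) (⌈log₂2^n⌉≡n k) (⌈log₂⌉-mono-≤ n≤)

n≤2^n : ∀ n → n ≤ 2 ^ n
n≤2^n zero    = z≤n
n≤2^n (suc n) = +-mono-≤ (m^n>0 2 n) (≤-trans (n≤2^n n) (m≤m+n _ 0))

argmin : (f : ℕ → ℕ) → ∀ {a b} → a ≤ b →
  ∃[ n ] a ≤ n × n ≤ b × (∀ {k} → a ≤ k → k ≤ b → f n ≤ f k)
argmin f a≤b = go (≤⇒≤′ a≤b)
  where
  go : ∀ {a b} → a ≤′ b → ∃[ n ] a ≤ n × n ≤ b × (∀ {k} → a ≤ k → k ≤ b → f n ≤ f k)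
  go {a} ≤′-refl = a , ≤-refl , ≤-refl , λ a≤k k≤a → ≤-reflexive (cong f (≤-antisym a≤k k≤a))
  go {a} {suc b} (≤′-step a≤b) with go a≤b
  ... | n , a≤n , n≤b , min with ≤-total (f n) (f (suc b))
  ...   | inj₁ fn≤ = n , a≤n , m≤n⇒m≤1+n n≤b , min′
    where
    min′ : ∀ {k} → a ≤ k → k ≤ suc b → f n ≤ f k
    min′ a≤k k≤1+b with m≤n⇒m<n∨m≡n k≤1+b
    ... | inj₁ k<1+b = min a≤k (s≤s⁻¹ k<1+b)
    ... | inj₂ refl  = fn≤
  ...   | inj₂ ≤fn = suc b , m≤n⇒m≤1+n (≤′⇒≤ a≤b) , ≤-refl , min′
    where
    min′ : ∀ {k} → a ≤ k → k ≤ suc b → f (suc b) ≤ f k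
    min′ a≤k k≤1+b with m≤n⇒m<n∨m≡n k≤1+b
    ... | inj₁ k<1+b = ≤-trans ≤fn (min a≤k (s≤s⁻¹ k<1+b))
    ... | inj₂ refl  = ≤-refl

-- The search moves up from `N₀` while `g (suc N)` is at most `n`. It ends because `N < g N ≤ n`
-- throughout, so `n` is enough fuel.
consecutive : (g : ℕ → ℕ) → (∀ N → N < g N) → ∀ {N₀ n} → g N₀ ≤ n →
  ∃[ N ] N₀ ≤ N × g N ≤ n × n ≤ g (suc N)
consecutive g N<g {N₀} {n} g≤n = search n N₀ ≤-refl g≤n (m≤n+m n N₀)
  where
  search : ∀ fuel N → N₀ ≤ N → g N ≤ n → n ≤ N + fuel → ∃[ N ] N₀ ≤ N × g N ≤ n × n ≤ g (suc N)
  search zero N N₀≤N g≤n n≤ =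
    contradiction (≤-trans n≤ (≤-reflexive (+-identityʳ N))) (<⇒≱ (<-≤-trans (N<g N) g≤n))
  search (suc fuel) N N₀≤N g≤n n≤ with ≤-total n (g (suc N))
  ... | inj₁ n≤g = N , N₀≤N , g≤n , n≤g
  ... | inj₂ g≤n′ = search fuel (suc N) (m≤n⇒m≤1+n N₀≤N) g≤n′ (≤-trans n≤ (≤-reflexive (+-suc N fuel)))

-- The number of vertices and its logarithm

module Sizes (m b c₀ : ℕ) where

  -- The summand threshold N + 8 of order N makes threshold N fit in a word and the
  -- logarithm of the number of vertices at least 3.
  universe height column threshold order : ℕ → ℕ
  universe N  = ⌈log₂ N ⌉ ^ c₀
  height N    = suc ⌈log₂ N ⌉
  column N    = columnLength m b (height N)
  threshold N = 4 * column N
  order N     = N + N + ((N + N) * (universe N * column N) + (threshold N + 8))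

  column-mono : ∀ {M N} → M ≤ N → column M ≤ column N
  column-mono M≤N = s≤s (*-monoʳ-≤ (suc m) (+-monoˡ-≤ b (*-monoʳ-≤ 2 (s≤s (⌈log₂⌉-mono-≤ M≤N)))))

  order-mono : ∀ {M N} → M ≤ N → order M ≤ order N
  order-mono M≤N = +-mono-≤ (+-mono-≤ M≤N M≤N) (+-mono-≤
    (*-mono-≤ (+-mono-≤ M≤N M≤N) (*-mono-≤ (^-monoˡ-≤ c₀ (⌈log₂⌉-mono-≤ M≤N)) (column-mono M≤N)))
    (+-monoˡ-≤ 8 (*-monoʳ-≤ 4 (column-mono M≤N))))

  order-+ : ∀ N o → order N + o ≡ N + N + ((N + N) * (universe N * column N) + (threshold N + 8 + o))
  order-+ N o = trans (+-assoc (N + N) _ o)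
    (cong (λ x → N + N + x) (+-assoc ((N + N) * (universe N * column N)) _ o))

  threshold+8≤order : ∀ N → threshold N + 8 ≤ order N
  threshold+8≤order N = ≤-trans (m≤n+m _ ((N + N) * (universe N * column N))) (m≤n+m _ (N + N))

  N+8≤order : ∀ N → N + 8 ≤ order N
  N+8≤order N = +-mono-≤ (m≤m+n N N)
    (≤-trans (m≤n+m 8 (threshold N)) (m≤n+m _ ((N + N) * (universe N * column N))))

  N<order : ∀ N → N < order N
  N<order N = ≤-trans (≤-trans (≤-reflexive (+-comm 1 N)) (+-monoʳ-≤ N (s≤s z≤n))) (N+8≤order N)

  columnFactor orderFactor : ℕ
  columnFactor = 1 + suc m * (4 + b)
  orderFactor  = 2 + 2 * columnFactor + (4 * columnFactor + 8)

  -- The column length is linear in the logarithm and the universe is its power `c₀`, so every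
  -- summand is a multiple of `N * λ′ ^ suc c₀` at most. The bound `λ′` is left open: it becomes a
  -- logarithm of the number of sets for the word size and of the number of vertices for the space.
  order≤ : ∀ N {λ′} → 1 ≤ N → 1 ≤ λ′ → ⌈log₂ N ⌉ ≤ λ′ → order N ≤ orderFactor * (N * λ′ ^ suc c₀)
  order≤ N {x} 1≤N 1≤x log≤x = begin
    order N
      ≤⟨ +-monoʳ-≤ (N + N) (+-mono-≤ (*-monoʳ-≤ (N + N) (*-mono-≤ (^-monoˡ-≤ c₀ log≤x) column≤))
          (+-monoˡ-≤ 8 (*-monoʳ-≤ 4 column≤))) ⟩
    N + N + ((N + N) * (x ^ c₀ * (K * x)) + (4 * (K * x) + 8))
      ≡⟨ regroup N (x ^ c₀) K x ⟩
    2 * N + 2 * K * P + (4 * K * x + 8 * 1)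
      ≤⟨ +-mono-≤ (+-monoˡ-≤ (2 * K * P) (*-monoʳ-≤ 2 N≤P))
          (+-mono-≤ (*-monoʳ-≤ (4 * K) x≤P) (*-monoʳ-≤ 8 1≤P)) ⟩
    2 * P + 2 * K * P + (4 * K * P + 8 * P)
      ≡⟨ factor P K ⟩
    orderFactor * P ∎
    where
    open ≤-Reasoning
    K = columnFactor
    P = N * x ^ suc c₀
    instance
      x≢0 : NonZero x
      x≢0 = >-nonZero 1≤x
      N≢0 : NonZero N
      N≢0 = >-nonZero 1≤N
      x^≢0 : NonZero (x ^ c₀)
      x^≢0 = m^n≢0 x c₀
    x≤x^ : x ≤ x ^ suc c₀
    x≤x^ = m≤m*n x (x ^ c₀)
    N≤P : N ≤ P
    N≤P = m≤m*n N (x ^ suc c₀) {{m^n≢0 x (suc c₀)}}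
    x≤P : x ≤ P
    x≤P = ≤-trans x≤x^ (m≤n*m (x ^ suc c₀) N)
    1≤P : 1 ≤ P
    1≤P = ≤-trans 1≤x x≤P
    regroup : ∀ N y K x → N + N + ((N + N) * (y * (K * x)) + (4 * (K * x) + 8)) ≡
      2 * N + 2 * K * (N * (x * y)) + (4 * K * x + 8 * 1)
    regroup = solve 4 (λ N y K x → N :+ N :+ ((N :+ N) :* (y :* (K :* x)) :+ (con 4 :* (K :* x) :+ con 8))
      := con 2 :* N :+ con 2 :* K :* (N :* (x :* y)) :+ (con 4 :* K :* x :+ con 8 :* con 1)) refl
      where open +-*-Solver
    factor : ∀ P K → 2 * P + 2 * K * P + (4 * K * P + 8 * P) ≡ (2 + 2 * K + (4 * K + 8)) * P
    factor = solve 2 (λ P K → con 2 :* P :+ con 2 :* K :* P :+ (con 4 :* K :* P :+ con 8 :* P)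
      := (con 2 :+ con 2 :* K :+ (con 4 :* K :+ con 8)) :* P) refl
      where open +-*-Solver
    column≤ : column N ≤ K * x
    column≤ = begin
      suc (suc m * (2 * suc ⌈log₂ N ⌉ + b))
        ≤⟨ s≤s (*-monoʳ-≤ (suc m) (+-mono-≤ (*-monoʳ-≤ 2 (+-mono-≤ 1≤x log≤x)) (m≤m*n b x))) ⟩
      1 + suc m * (2 * (x + x) + b * x)     ≤⟨ +-monoˡ-≤ _ 1≤x ⟩
      x + suc m * (2 * (x + x) + b * x)     ≡⟨ collect x m b ⟩
      K * x                                 ∎
      where
      collect : ∀ x m b → x + suc m * (2 * (x + x) + b * x) ≡ (1 + suc m * (4 + b)) * x
      collect = solve 3 (λ x m b → x :+ (con 1 :+ m) :* (con 2 :* (x :+ x) :+ b :* x)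
        := (con 1 :+ (con 1 :+ m) :* (con 4 :+ b)) :* x) refl
        where open +-*-Solver

  -- Keeps the words at a logarithmic number of bits in `N`, although the padded graph may have up
  -- to `order (suc N)` vertices.
  log-order≤ : ∀ N → suc ⌈log₂ order (suc N) ⌉ ≤ (3 + orderFactor + c₀) * suc ⌈log₂ N ⌉
  log-order≤ N = begin
    suc ⌈log₂ order (suc N) ⌉             ≤⟨ s≤s (⌈log₂⌉≤ order≤2^) ⟩
    1 + (orderFactor + (x + x * suc c₀))
      ≤⟨ +-mono-≤ (s≤s (z≤n {⌈log₂ N ⌉})) (+-monoˡ-≤ _ (m≤m*n orderFactor x)) ⟩
    x + (orderFactor * x + (x + x * suc c₀)) ≡⟨ collect x orderFactor c₀ ⟩
    (3 + orderFactor + c₀) * x            ∎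
    where
    open ≤-Reasoning
    x = suc ⌈log₂ N ⌉
    1+N≤2^x : suc N ≤ 2 ^ x
    1+N≤2^x = +-mono-≤ (m^n>0 2 ⌈log₂ N ⌉) (≤-trans (n≤2^⌈log₂n⌉ N) (m≤m+n _ 0))
    order≤2^ : order (suc N) ≤ 2 ^ (orderFactor + (x + x * suc c₀))
    order≤2^ = begin
      order (suc N)                             ≤⟨ order≤ (suc N) (s≤s z≤n) (s≤s z≤n) (⌈log₂⌉≤ 1+N≤2^x) ⟩
      orderFactor * (suc N * x ^ suc c₀)
        ≤⟨ *-mono-≤ (n≤2^n orderFactor) (*-mono-≤ 1+N≤2^x (^-monoˡ-≤ (suc c₀) (n≤2^n x))) ⟩
      2 ^ orderFactor * (2 ^ x * (2 ^ x) ^ suc c₀)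
        ≡⟨ cong (λ y → 2 ^ orderFactor * (2 ^ x * y)) (^-*-assoc 2 x (suc c₀)) ⟩
      2 ^ orderFactor * (2 ^ x * 2 ^ (x * suc c₀))
        ≡⟨ cong (2 ^ orderFactor *_) (^-distribˡ-+-* 2 x (x * suc c₀)) ⟨
      2 ^ orderFactor * 2 ^ (x + x * suc c₀)    ≡⟨ ^-distribˡ-+-* 2 orderFactor (x + x * suc c₀) ⟨
      2 ^ (orderFactor + (x + x * suc c₀))      ∎
    collect : ∀ x K c₀ → x + (K * x + (x + x * suc c₀)) ≡ (3 + K + c₀) * x
    collect = solve 3 (λ x K c₀ → x :+ (K :* x :+ (x :+ x :* (con 1 :+ c₀))) := (con 3 :+ K :+ c₀) :* x) refl
      where open +-*-Solver

  -- With at least 8 vertices the logarithm is at least 3, so its cube absorbs the factor 7; this is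
  -- where the exponent `3 + c₀` comes from.
  degree-bound : ∀ {N n k} → order N ≤ n → 3 + c₀ ≤ k → 6 + universe N ≤ ⌈log₂ n ⌉ ^ k
  degree-bound {N} {n} {k} order≤n c₀≤k = begin
    6 + universe N
      ≤⟨ +-mono-≤ (m≤m*n 6 (x ^ c₀)) (^-monoˡ-≤ c₀ (⌈log₂⌉-mono-≤ (≤-trans (<⇒≤ (N<order N)) order≤n))) ⟩
    6 * x ^ c₀ + x ^ c₀     ≡⟨ +-comm (6 * x ^ c₀) (x ^ c₀) ⟩
    7 * x ^ c₀              ≤⟨ *-monoˡ-≤ (x ^ c₀) (≤-trans (m≤m+n 7 20) (^-monoˡ-≤ 3 3≤x)) ⟩
    x ^ 3 * x ^ c₀          ≡⟨ ^-distribˡ-+-* x 3 c₀ ⟨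
    x ^ (3 + c₀)            ≤⟨ ^-monoʳ-≤ x c₀≤k ⟩
    x ^ k                   ∎
    where
    open ≤-Reasoning
    x = ⌈log₂ n ⌉
    3≤x : 3 ≤ x
    3≤x = ⌈log₂⌉-mono-≤ {8} (≤-trans (≤-trans (m≤n+m 8 N) (N+8≤order N)) order≤n)
    instance
      x≢0 : NonZero x
      x≢0 = >-nonZero (≤-trans (s≤s z≤n) 3≤x)
      x^≢0 : NonZero (x ^ c₀)
      x^≢0 = m^n≢0 x c₀

-- The reduction

length≤0⇒[] : {A : Set} {xs : List A} → length xs ≤ 0 → xs ≡ []
length≤0⇒[] {xs = []} _ = refl

module Reduction (ε c : ℝ) (m b : ℕ) (1/m<ε : lower ε (frac 1 m)) (c<b : upper c (frac b 0))
  (c₀ k : ℕ) (c₀≤k : 3 + c₀ ≤ k) where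

  open Sizes m b c₀

  Oracle : Problem
  Oracle = DistanceOracle ((+ 2 / 1) ⊖ ε) c k

  -- The numbering is the one that the decider assumes: it passes the first index on and adds `N` to
  -- the second.
  record Encoding (N n : ℕ) (𝒮 : Fin N → Subset (universe N)) : Set where
    field
      instance′ : Instance Oracle n
      left right : Fin N → Fin n
      toℕ-left  : ∀ i → toℕ (left i) ≡ toℕ i
      toℕ-right : ∀ j → toℕ (right j) ≡ N + toℕ j
      decides   : ∀ i j out → Correct Oracle instance′ (left i) (right j) out →
        below (threshold N) out ≡ true ⇔ Nonempty (𝒮 i ∩ 𝒮 j)

  open Encoding

  abstract
    -- Every set is entered twice, so that a query concerns two different vertices even if `i`
    -- equals `j`, and the lower bound on the distance applies to all pairs.
    encode : ∀ {N n} → order N ≤ n → ∀ 𝒮 → Encoding N n 𝒮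
    encode {N} {n} order≤n 𝒮 with m≤n⇒∃[o]m+o≡n order≤n
    -- The excess `o` and the summand `threshold N + 8` become isolated vertices; matching turns `n`
    -- into the vertex count of the gadget.
    ... | o , order+o≡n with refl ← trans (sym order+o≡n) (order-+ N o) = record
      { instance′ = graph , λ v → ≤-trans (degree≤ v) (degree-bound {N} order≤n c₀≤k)
      ; left      = λ i → setCode (i ↑ˡ N)
      ; right     = λ j → setCode (N ↑ʳ j)
      ; toℕ-left  = λ i → trans (toℕ-setCode _) (Fin.toℕ-↑ˡ i N)
      ; toℕ-right = λ j → trans (toℕ-setCode _) (Fin.toℕ-↑ʳ N j)
      ; decides   = λ i j out correct → mk⇔ (sound i j out correct) (complete i j out correct)
      }
      where
      padding : ℕ
      padding = threshold N + 8 + o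
      copies : Fin (N + N) → Subset (universe N)
      copies = Sum.[ 𝒮 , 𝒮 ] ∘ splitAt N
      -- The successor of this `M` is the column length `column N`.
      open Gadget (suc m * (2 * height N + b)) padding copies
      intersection : ∀ i j → 𝒮 i ∩ 𝒮 j ≡ copies (i ↑ˡ N) ∩ copies (N ↑ʳ j)
      intersection i j = sym (cong₂ _∩_
        (cong Sum.[ 𝒮 , 𝒮 ] (Fin.splitAt-↑ˡ N i N))
        (cong Sum.[ 𝒮 , 𝒮 ] (Fin.splitAt-↑ʳ N N j)))
      -- The heaps have `N + N` nodes, whence the successor in `height`.
      2N≤2^h : N + N ≤ 2 ^ height N
      2N≤2^h = +-mono-≤ (n≤2^⌈log₂n⌉ N) (≤-trans (n≤2^⌈log₂n⌉ N) (m≤m+n _ 0))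
      complete : ∀ i j out → (∀ d → IsDistance graph (setCode (i ↑ˡ N)) (setCode (N ↑ʳ j)) d →
          WithinStretch ((+ 2 / 1) ⊖ ε) c (fromℕ⁺ d) (estimate out)) →
        Nonempty (𝒮 i ∩ 𝒮 j) → below (threshold N) out ≡ true
      complete i j out within meet =
        let a , a≤ , walk = intersecting⇒close {height N} 2N≤2^h (i ↑ˡ N) (N ↑ʳ j)
                              (subst Nonempty (intersection i j) meet)
        in Threshold.walk⇒below ε c m b 1/m<ε c<b {out = out} within (height N) a≤ walk
      sound : ∀ i j out → (∀ d → IsDistance graph (setCode (i ↑ˡ N)) (setCode (N ↑ʳ j)) d →
          WithinStretch ((+ 2 / 1) ⊖ ε) c (fromℕ⁺ d) (estimate out)) →
        below (threshold N) out ≡ true → Nonempty (𝒮 i ∩ 𝒮 j)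
      sound i j out within below-true = subst Nonempty (sym (intersection i j))
        (decidable-stable (nonempty? (copies (i ↑ˡ N) ∩ copies (N ↑ʳ j))) λ disjoint → contradiction
          (trans (sym below-true) (Threshold.no-walk⇒¬below ε c m b 1/m<ε c<b {out = out} within
            (Potential.disjoint⇒far left≢right disjoint))) λ ())
        where
        left≢right : i ↑ˡ N ≢ N ↑ʳ j
        left≢right e = <⇒≢ (≤-trans (Fin.toℕ<n i) (m≤m+n N (toℕ j)))
          (trans (sym (Fin.toℕ-↑ˡ i N)) (trans (cong toℕ e) (Fin.toℕ-↑ʳ N j)))

  module _ (D : DataStructure Oracle) where

    store-of : ∀ {N n} → order N ≤ n → (Fin N → Subset (universe N)) → List (Word (wordSize D n))
    store-of order≤n 𝒮 = preprocess D (instance′ (encode order≤n 𝒮))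

    oracle-decides : ∀ {N n} (order≤n : order N ≤ n) 𝒮 i j → ∃[ out ]
      query (wordSize D n) (program D) (time D) (store-of order≤n 𝒮) (toℕ i) (N + toℕ j) ≡ just out
      × (below (threshold N) out ≡ true ⇔ Nonempty (𝒮 i ∩ 𝒮 j))
    oracle-decides {N} {n} order≤n 𝒮 i j =
      out ,
      subst₂ (λ x y → query (wordSize D n) (program D) (time D) (preprocess D (instance′ E)) x y ≡ just out)
        (toℕ-left E i) (toℕ-right E j) (proj₁ (proj₂ answer)) ,
      decides E i j out (proj₂ (proj₂ answer))
      where
      E = encode order≤n 𝒮
      answer = correct D (instance′ E) (left E i) (right E j)
      out = proj₁ answer

    -- With an empty store the oracle could not tell the family of empty sets
    -- from the family of full sets.
    space>0 : ∀ {N n} → 2 ≤ N → order N ≤ n → 0 < space D n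
    space>0 {N} {n} 2≤N order≤n = n≢0⇒n>0 impossible
      where
      i : Fin N
      i = fromℕ< (≤-trans (s≤s z≤n) 2≤N)
      x : Fin (universe N)
      x = fromℕ< (m^n>0 ⌈log₂ N ⌉ {{>-nonZero (⌈log₂⌉-mono-≤ 2≤N)}} c₀)
      empty : space D n ≡ 0 → ∀ (𝒮 : Fin N → Subset (universe N)) → store-of order≤n 𝒮 ≡ []
      empty space≡0 𝒮 = length≤0⇒[] (≤-trans (preprocess-space D _) (≤-reflexive space≡0))
      impossible : space D n ≢ 0
      impossible space≡0 = ∉⊥ (proj₁ (x∈p∩q⁻ ⊥ ⊥ (proj₂ ⊥-meets)))
        where
        none = oracle-decides order≤n (λ _ → ⊥) i i
        all  = oracle-decides order≤n (λ _ → ⊤) i i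
        same : proj₁ all ≡ proj₁ none
        same = just-injective (trans (sym (proj₁ (proj₂ all))) (trans
          (cong (λ memory → query (wordSize D n) (program D) (time D) memory (toℕ i) (N + toℕ i))
            (trans (empty space≡0 (λ _ → ⊤)) (sym (empty space≡0 (λ _ → ⊥)))))
          (proj₁ (proj₂ none))))
        ⊥-meets : Nonempty (⊥ ∩ ⊥)
        ⊥-meets = Equivalence.to (proj₂ (proj₂ none)) (subst (λ out → below (threshold N) out ≡ true) same
          (Equivalence.from (proj₂ (proj₂ all)) (x , x∈p∩q⁺ (∈⊤ , ∈⊤))))

    best : ∀ N → ∃[ n ] order N ≤ n × n ≤ order (suc N) ×
      (∀ {n′} → order N ≤ n′ → n′ ≤ order (suc N) → space D n ≤ space D n′)
    best N = argmin (space D) (order-mono (n≤1+n N))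

    vertices : ℕ → ℕ
    vertices N = proj₁ (best N)

    order≤vertices : ∀ N → order N ≤ vertices N
    order≤vertices N = proj₁ (proj₂ (best N))

    wordFactor : ℕ
    wordFactor = proj₁ (wordSize-upper D)

    setIntersection : DataStructure (SetIntersection c₀)
    setIntersection = record
      { wordSize         = width
      ; wordSize-lower   = λ N →
          ≤-trans (<⇒≤ (≤-trans (N<order N) (order≤vertices N))) (wordSize-lower D (vertices N))
      ; wordSize-upper   = wordFactor * (3 + orderFactor + c₀) , λ N → begin
          width N
            ≤⟨ proj₂ (wordSize-upper D) (vertices N) ⟩
          wordFactor * suc ⌈log₂ vertices N ⌉
            ≤⟨ *-monoʳ-≤ wordFactor (s≤s (⌈log₂⌉-mono-≤ (proj₁ (proj₂ (proj₂ (best N)))))) ⟩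
          wordFactor * suc ⌈log₂ order (suc N) ⌉
            ≤⟨ *-monoʳ-≤ wordFactor (log-order≤ N) ⟩
          wordFactor * ((3 + orderFactor + c₀) * suc ⌈log₂ N ⌉)
            ≡⟨ *-assoc wordFactor _ _ ⟨
          wordFactor * (3 + orderFactor + c₀) * suc ⌈log₂ N ⌉ ∎
      -- The two cells in front hold the threshold and the offset `N` of the right copies.
      ; space            = λ N → 2 + space D (vertices N)
      ; preprocess       = λ {N} 𝒮 →
          word (width N) (threshold N) ∷ word (width N) N ∷ store-of (order≤vertices N) 𝒮
      ; preprocess-space = λ {N} 𝒮 → s≤s (s≤s (preprocess-space D (instance′ (encode (order≤vertices N) 𝒮))))
      ; program          = decider (program D)
      ; time             = 9 + time D
      ; correct          = answers
      }
      where
      open ≤-Reasoning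
      width : ℕ → ℕ
      width N = wordSize D (vertices N)
      order≤2^width : ∀ N → order N ≤ 2 ^ width N
      order≤2^width N = ≤-trans (order≤vertices N) (wordSize-lower D (vertices N))
      bit≢0 : ∀ {x} → bit x ≢ 0 ⇔ x ≡ true
      bit≢0 {true}  = mk⇔ (λ _ → refl) (λ _ ())
      bit≢0 {false} = mk⇔ (λ 0≢0 → contradiction refl 0≢0) (λ ())
      answers : ∀ {N} (𝒮 : Fin N → Subset (universe N)) i j → ∃[ out ]
        query (width N) (decider (program D)) (9 + time D)
          (word (width N) (threshold N) ∷ word (width N) N ∷ store-of (order≤vertices N) 𝒮)
          (toℕ i) (toℕ j) ≡ just out
        × (proj₁ out ≢ 0 ⇔ Nonempty (𝒮 i ∩ 𝒮 j))
      answers {N} 𝒮 i j = _ , proj₂ simulated ,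
        mk⇔ (Equivalence.to (proj₂ (proj₂ d)) ∘ Equivalence.to bit≢0)
          (Equivalence.from bit≢0 ∘ Equivalence.from (proj₂ (proj₂ d)))
        where
        d = oracle-decides (order≤vertices N) 𝒮 i j
        simulated = decider-query (program D) (width N)
          (≤-trans (m≤n+m 2 (N + 6))
            (≤-trans (≤-reflexive (+-assoc N 6 2)) (≤-trans (N+8≤order N) (order≤2^width N))))
          {threshold N} {N}
          (≤-trans (≤-trans (≤-reflexive (+-comm 1 (threshold N))) (+-monoʳ-≤ (threshold N) (s≤s z≤n)))
            (≤-trans (threshold+8≤order N) (order≤2^width N)))
          (<-≤-trans (N<order N) (order≤2^width N))
          (time D) (store-of (order≤vertices N) 𝒮) (toℕ i) (toℕ j)
          (<-≤-trans (<-trans (Fin.toℕ<n j) (N<order N)) (order≤2^width N)) (proj₁ (proj₂ d))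

    -- Any large `n` lies between `order N` and `order (suc N)` for some `N`, so it exceeds `N` by a
    -- polylogarithmic factor at most. By minimality, the oracle on `vertices N` vertices takes at
    -- most the space that it takes on `n`; the two extra cells are absorbed because that space is
    -- positive.
    transfer : Ω̃ (λ N → N ^ 2) (space setIntersection) → Ω̃ (λ n → n ^ 2) (space D)
    transfer (C , κ , N₀ , bound) =
      -- Squaring `n ≤ K * (2 * N * Λ)` gives `4 * (K * K)` and twice the exponent `suc c₀`; the
      -- bound on `N ^ 2` gives `3 * C` and `κ`. The 2 in `N₀ ⊔ 2` is what `space>0` asks for.
      4 * (orderFactor * orderFactor) * (3 * C) , suc c₀ + (suc c₀ + κ) , order (N₀ ⊔ 2) , lower-bound
      where
      open ≤-Reasoning
      lower-bound : ∀ n → order (N₀ ⊔ 2) ≤ n →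
        n ^ 2 ≤ 4 * (orderFactor * orderFactor) * (3 * C) * ⌈log₂ n ⌉ ^ (suc c₀ + (suc c₀ + κ)) * space D n
      lower-bound n order≤n = begin
        n ^ 2
          ≤⟨ ^-monoˡ-≤ 2 n≤ ⟩
        (K * (2 * N * Λ)) ^ 2
          ≡⟨ square K N Λ ⟩
        4 * (K * K) * (Λ * Λ) * N ^ 2
          ≤⟨ *-monoʳ-≤ (4 * (K * K) * (Λ * Λ)) N²≤ ⟩
        4 * (K * K) * (Λ * Λ) * (C * x ^ κ * (3 * s))
          ≡⟨ regroup K Λ C (x ^ κ) s ⟩
        4 * (K * K) * (3 * C) * (Λ * (Λ * x ^ κ)) * s
          ≡⟨ cong (λ p → 4 * (K * K) * (3 * C) * p * s)
              (trans (cong (Λ *_) (sym (^-distribˡ-+-* x (suc c₀) κ)))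
                (sym (^-distribˡ-+-* x (suc c₀) (suc c₀ + κ)))) ⟩
        4 * (K * K) * (3 * C) * x ^ (suc c₀ + (suc c₀ + κ)) * s ∎
        where
        range = consecutive order N<order {N₀ ⊔ 2} order≤n
        N = proj₁ range
        ≤N = proj₁ (proj₂ range)
        order≤ₙ = proj₁ (proj₂ (proj₂ range))
        n≤order = proj₂ (proj₂ (proj₂ range))
        K = orderFactor
        x = ⌈log₂ n ⌉
        Λ = x ^ suc c₀
        s = space D n
        2≤N : 2 ≤ N
        2≤N = ≤-trans (m≤n⊔m N₀ 2) ≤N
        log≤x : ⌈log₂ suc N ⌉ ≤ x
        log≤x = ⌈log₂⌉-mono-≤ (≤-trans (N<order N) order≤ₙ)
        1≤x : 1 ≤ x
        1≤x = ⌈log₂⌉-mono-≤ (≤-trans 2≤N (≤-trans (<⇒≤ (N<order N)) order≤ₙ))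
        n≤ : n ≤ K * (2 * N * Λ)
        n≤ = begin
          n                    ≤⟨ n≤order ⟩
          order (suc N)        ≤⟨ order≤ (suc N) (s≤s z≤n) 1≤x log≤x ⟩
          K * (suc N * Λ)      ≤⟨ *-monoʳ-≤ K (*-monoˡ-≤ Λ (+-mono-≤ (≤-trans (s≤s z≤n) 2≤N) (m≤m+n N 0))) ⟩
          K * (2 * N * Λ)      ∎
        space≤ : 2 + space D (vertices N) ≤ 3 * s
        space≤ = begin
          2 + space D (vertices N) ≤⟨ +-monoʳ-≤ 2 (proj₂ (proj₂ (proj₂ (best N))) order≤ₙ n≤order) ⟩
          2 + s                    ≤⟨ +-monoˡ-≤ s (*-monoʳ-≤ 2 (space>0 2≤N order≤ₙ)) ⟩
          2 * s + s                ≡⟨ +-comm (2 * s) s ⟩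
          3 * s                    ∎
        N²≤ : N ^ 2 ≤ C * x ^ κ * (3 * s)
        N²≤ = begin
          N ^ 2                                              ≤⟨ bound N (≤-trans (m≤m⊔n N₀ 2) ≤N) ⟩
          C * ⌈log₂ N ⌉ ^ κ * (2 + space D (vertices N))
            ≤⟨ *-mono-≤ (*-monoʳ-≤ C (^-monoˡ-≤ κ (≤-trans (⌈log₂⌉-mono-≤ (n≤1+n N)) log≤x))) space≤ ⟩
          C * x ^ κ * (3 * s)                                ∎
        open +-*-Solver
        square : ∀ K N Λ → (K * (2 * N * Λ)) ^ 2 ≡ 4 * (K * K) * (Λ * Λ) * N ^ 2
        square = solve 3 (λ K N Λ → (K :* (con 2 :* N :* Λ)) :^ 2 := con 4 :* (K :* K) :* (Λ :* Λ) :* N :^ 2) refl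
        regroup : ∀ K Λ C y s →
          4 * (K * K) * (Λ * Λ) * (C * y * (3 * s)) ≡ 4 * (K * K) * (3 * C) * (Λ * (Λ * y)) * s
        regroup = solve 5 (λ K Λ C y s → con 4 :* (K :* K) :* (Λ :* Λ) :* (C :* y :* (con 3 :* s))
          := con 4 :* (K :* K) :* (con 3 :* C) :* (Λ :* (Λ :* y)) :* s) refl

theorem1p6 : (ε c : ℝ) → Positive ε → Positive c →
    SetIntersectionHypothesis →
    ∃[ k₀ ] ∀ k → k₀ ≤ k →
    RequiresSpace (DistanceOracle ((+ 2 / 1) ⊖ ε) c k) (λ n → n ^ 2)
theorem1p6 ε c ε>0 c>0 (c₀ , hypothesis) = 3 + c₀ , λ k c₀≤k D →
  Reduction.transfer ε c m (suc b) 1/m<ε c<b c₀ k c₀≤k D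
    (hypothesis (Reduction.setIntersection ε c m (suc b) 1/m<ε c<b c₀ k c₀≤k D))
  where
  -- Roundedness at 0 yields a rational strictly between 0 and `ε`, below which a unit fraction is
  -- found.
  m∃ : ∃[ m ] lower ε (frac 1 m)
  m∃ with e , 0<e , e<ε ← Equivalence.to (lower-rounded ε _) ε>0
     with m , 1/m<e ← archimedean e 0<e = m , lower-closed ε 1/m<e e<ε
  m = proj₁ m∃
  1/m<ε = proj₂ m∃
  b = proj₁ (upper-ℕ c)
  c<b = proj₂ (upper-ℕ c)
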